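{- Let $\mathcal X$ be the vertex set of a finite distance-regular graph of diameter $n$ with graph distance $d$, and let $Z\subset\mathcal X$, $|Z|=N$. Let $A_k=\frac1N|\{(z_1,z_2)\in Z^2: d(z_1,z_2)=k\}|$, $k=1,\dots,n$. Then $$D^{L_2}(Z)=\frac12\Big(\frac1{|\mathcal X|}\sum_{i,j=0}^n\sum_{k=|i-j|}^{i+j}n_kp_{ij}^k|i-j|-\frac1N\sum_{k=1}^nA_k\sum_{\substack{i,j\\|i-j|\le k\le i+j}}p_{ij}^k|i-j|\Big),$$ where terms with $k>n$ are zero.
   Context: For $x,y$ with $d(x,y)=k$, the intersection number $p_{ij}^k=|\{u\in\mathcal X:d(x,u)=i,\ d(y,u)=j\}|$ depends only on $k$ (distance-regularity); $n_k=|\{u:d(x,u)=k\}|$ is the valency. $B(x,t)=\{y:d(x,y)\le t\}$ and $D^{L_2}(Z)=\sum_{t=0}^n\sum_{x\in\mathcal X}\Big(\frac1N\sum_{z\in Z}\mathbb 1_{B(x,t)}(z)-\frac{|B(x,t)|}{|\mathcal X|}\Big)^2$. -}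

module Defs where

open import Data.Bool using (Bool; true; false; _∧_; _∨_; if_then_else_; T)
open import Data.Nat as ℕ using (ℕ; zero; suc; _∸_; _≤_; _<_; _⊓_; _≤ᵇ_; _≡ᵇ_; ∣_-_∣)
open import Data.Fin using (Fin)
open import Data.Fin.Properties using (_≟_)
open import Data.Fin.Subset using (Subset; ∣_∣)
open import Data.Vec using (lookup)
open import Data.List using (List; map; upTo; allFin)
open import Data.Nat.ListAction using (sum)
open import Data.Bool.ListAction using (any)
open import Data.List as L using ()
open import Data.Integer using (+_)
open import Data.Rational as ℚ using (ℚ; _/_; 0ℚ)
open import Data.Product using (∃; ∃-syntax; _×_)
open import Relation.Binary.PropositionalEquality using (_≡_)
open import Relation.Nullary.Decidable using (⌊_⌋)

sumFin : {m : ℕ} → (Fin m → ℕ) → ℕ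
sumFin {m} f = sum (map f (allFin m))

count : {m : ℕ} → (Fin m → Bool) → ℕ
count P = sumFin (λ x → if P x then 1 else 0)

-- Σ_{k=a}^{b} f k  (empty if b < a)
sumFromTo : ℕ → ℕ → (ℕ → ℕ) → ℕ
sumFromTo a b f = sum (map (λ i → f (a ℕ.+ i)) (upTo (suc b ∸ a)))

sumℚ : List ℚ → ℚ
sumℚ = L.foldr ℚ._+_ 0ℚ

sumFinℚ : {m : ℕ} → (Fin m → ℚ) → ℚ
sumFinℚ {m} f = sumℚ (map f (allFin m))

sumFromToℚ : ℕ → ℕ → (ℕ → ℚ) → ℚ
sumFromToℚ a b f = sumℚ (map (λ i → f (a ℕ.+ i)) (upTo (suc b ∸ a)))

-- the rational number a/b  (b = 0 never occurs in the theorem; value 0 then)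
frac : ℕ → ℕ → ℚ
frac a zero    = 0ℚ
frac a (suc b) = (+ a) / suc b

record SimpleGraph (m : ℕ) : Set where
  field
    adj    : Fin m → Fin m → Bool
    sym    : ∀ x y → adj x y ≡ adj y x
    irrefl : ∀ x → adj x x ≡ false

module _ {m : ℕ} (G : SimpleGraph m) where
  open SimpleGraph G

  -- within ℓ x y = true  iff  there is a walk of length ≤ ℓ from x to y
  within : ℕ → Fin m → Fin m → Bool
  within zero    x y = ⌊ x ≟ y ⌋
  within (suc ℓ) x y = within ℓ x y ∨ any (λ z → adj x z ∧ within ℓ z y) (allFin m)

  distSearch : ℕ → ℕ → Fin m → Fin m → ℕ
  distSearch start zero     x y = start
  distSearch start (suc f)  x y = if within start x y then start else distSearch (suc start) f x y

  -- graph distance (shortest path length); in a connected graph on m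
  -- vertices every distance is < m, so the search with fuel m finds it.
  dist : Fin m → Fin m → ℕ
  dist x y = distSearch 0 m x y

  Connected : Set
  Connected = ∀ x y → ∃[ ℓ ] T (within ℓ x y)

  inBall : Fin m → ℕ → Fin m → Bool
  inBall x t y = dist x y ≤ᵇ t

  record IsDistanceRegular (n : ℕ) (p : ℕ → ℕ → ℕ → ℕ) (nv : ℕ → ℕ) : Set where
    field
      connected     : Connected
      diam-bound    : ∀ x y → dist x y ≤ n
      diam-attained : ∃[ x ] ∃[ y ] dist x y ≡ n
      intersection  : ∀ i j x y →
                      count (λ u → (dist x u ≡ᵇ i) ∧ (dist y u ≡ᵇ j)) ≡ p i j (dist x y)
      valency       : ∀ k x → count (λ u → dist x u ≡ᵇ k) ≡ nv k

  DL2 : (n : ℕ) → Subset m → ℚ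
  DL2 n Z = sumFromToℚ 0 n (λ t → sumFinℚ (λ x →
              let e = frac (count (λ z → lookup Z z ∧ inBall x t z)) ∣ Z ∣
                        ℚ.- frac (count (inBall x t)) m
              in e ℚ.* e))

  A : Subset m → ℕ → ℚ
  A Z k = frac (sumFin (λ z₁ → count (λ z₂ →
               lookup Z z₁ ∧ lookup Z z₂ ∧ (dist z₁ z₂ ≡ᵇ k)))) ∣ Z ∣

-- First sum on the right: Σ_{i,j=0}^{n} Σ_{k=|i-j|}^{i+j} n_k p_{ij}^k |i-j|,
-- terms with k > n being zero (so k runs up to min(i+j, n)).
firstSum : (n : ℕ) (p : ℕ → ℕ → ℕ → ℕ) (nv : ℕ → ℕ) → ℕ
firstSum n p nv =
  sumFromTo 0 n (λ i → sumFromTo 0 n (λ j →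
    sumFromTo ∣ i - j ∣ ((i ℕ.+ j) ⊓ n) (λ k → nv k ℕ.* p i j k ℕ.* ∣ i - j ∣)))

innerSum : (n : ℕ) (p : ℕ → ℕ → ℕ → ℕ) (k : ℕ) → ℕ
innerSum n p k =
  sumFromTo 0 n (λ i → sumFromTo 0 n (λ j →
    if (∣ i - j ∣ ≤ᵇ k) ∧ (k ≤ᵇ i ℕ.+ j) then p i j k ℕ.* ∣ i - j ∣ else 0))

rhs : {m : ℕ} (G : SimpleGraph m) (n : ℕ) (p : ℕ → ℕ → ℕ → ℕ) (nv : ℕ → ℕ)
      (Z : Subset m) → ℚ
rhs {m} G n p nv Z =
  ℚ.½ ℚ.* ( frac (firstSum n p nv) m
          ℚ.- frac 1 ∣ Z ∣ ℚ.* sumFromToℚ 1 n (λ k → A G Z k ℚ.* frac (innerSum n p k) 1))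

module Submission where

-- With a_t(x) = |Z ∩ B(x,t)| and β_t = |B(x,t)|, expanding the square and using
-- Σ_x a_t(x) = N β_t gives  D^{L₂}(Z) = N⁻² Σ_t Σ_x a_t(x)² − m⁻¹ Σ_t β_t².  The key identity
--   Σ_u |d(x,u) − d(y,u)| + 2 Σ_{t ≤ n} |B(x,t) ∩ B(y,t)| + 2 Σ_u d(x,u) = 2 m (n + 1)
-- for all vertices x, y follows by summing over u the elementary identity
-- |a − b| + 2 #{t ≤ n : a, b ≤ t} + a + b = 2 (n + 1); by distance-regularity its first
-- term is Σ_{i,j} p_{ij}^{d(x,y)} |i − j|.  Averaging the key identity over the pairs
-- (x₀, y) and over Z² expresses Σ_t β_t² and Σ_t Σ_x a_t(x)² through the two sums of the theorem.

open import Defs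
open import Algebra.Properties.CommutativeSemigroup using (interchange)
open import Data.Bool using (Bool; true; false; _∧_; if_then_else_; T)
open import Data.Bool.Properties using (T-∨; T-∧; T-≡; ∧-assoc)
open import Data.Empty using (⊥; ⊥-elim)
open import Data.Fin as Fin using (Fin)
open import Data.Fin.Subset using (Subset; ∣_∣)
open import Data.Integer as ℤ using ()
open import Data.Integer.Properties as ℤP using (pos-+; pos-*)
import Data.Integer.Solver as ℤSolver
open import Data.List using (List; []; _∷_; map; upTo; allFin; length)
import Data.List.Properties as LP
open import Data.List.Membership.Propositional using (_∈_; lose)
open import Data.List.Membership.Propositional.Properties using (∈-allFin)
open import Data.List.Relation.Unary.Any using (here; there; satisfied)
open import Data.List.Relation.Unary.Any.Properties using (any⁺; any⁻)
open import Data.Nat as ℕ using (ℕ; zero; suc; _+_; _*_; _≤_; _<_; _⊓_; _≡ᵇ_; _≤ᵇ_; s≤s; z≤n; ∣_-_∣)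
import Data.Nat.Properties as ℕP
open import Data.Nat.ListAction using (sum)
open import Data.Nat.Solver using (module +-*-Solver)
open import Data.Product using (∃-syntax; _×_; _,_)
open import Data.Rational as ℚ using (ℚ; 0ℚ; 1ℚ; ½; toℚᵘ)
open import Data.Rational.Properties as ℚP using (toℚᵘ-injective; toℚᵘ-fromℚᵘ; toℚᵘ-homo-+; toℚᵘ-homo-*)
import Data.Rational.Solver as ℚSolver
open import Data.Rational.Unnormalised as ℚᵘ using (mkℚᵘ; *≡*)
import Data.Rational.Unnormalised.Properties as ℚᵘP
open import Data.Sum using (_⊎_; inj₁; inj₂)
open import Data.Vec using ([]; _∷_; lookup)
open import Function using (_∘_; Equivalence)
open import Relation.Binary.PropositionalEquality
open import Relation.Nullary using (¬_; yes; no; contradiction)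
open import Relation.Nullary.Decidable using (Dec; T?; map′; toWitness; fromWitness)

private variable X Y : Set

⟦_⟧ : Bool → ℕ
⟦ b ⟧ = if b then 1 else 0

⟦∧⟧ : ∀ a b → ⟦ a ∧ b ⟧ ≡ ⟦ a ⟧ * ⟦ b ⟧
⟦∧⟧ false b = refl
⟦∧⟧ true  b = sym (ℕP.+-identityʳ ⟦ b ⟧)

if-then-0 : ∀ b x → (if b then x else 0) ≡ ⟦ b ⟧ * x
if-then-0 false x = refl
if-then-0 true  x = sym (ℕP.+-identityʳ x)

⟦⟧≤1 : ∀ b → ⟦ b ⟧ ≤ 1
⟦⟧≤1 false = z≤n
⟦⟧≤1 true  = s≤s z≤n

⟦⟧-mono : ∀ {a b} → (T a → T b) → ⟦ a ⟧ ≤ ⟦ b ⟧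
⟦⟧-mono {false} _ = z≤n
⟦⟧-mono {true}  h with h _
⟦⟧-mono {true} {true} h | _ = ℕP.≤-refl

⟦⟧-< : ∀ {a b} → ¬ T a → T b → ⟦ a ⟧ < ⟦ b ⟧
⟦⟧-< {false} {true} _ _ = s≤s z≤n
⟦⟧-< {true}         ¬a _ = ⊥-elim (¬a _)

∑ : List X → (X → ℕ) → ℕ
∑ xs f = sum (map f xs)

syntax ∑ xs (λ x → e) = ∑[ x ∈ xs ] e

∑-cong : ∀ (xs : List X) {f g : X → ℕ} → (∀ x → f x ≡ g x) → ∑ xs f ≡ ∑ xs g
∑-cong []       e = refl
∑-cong (x ∷ xs) e = cong₂ _+_ (e x) (∑-cong xs e)

∑-+ : ∀ (xs : List X) (f g : X → ℕ) → ∑[ x ∈ xs ] (f x + g x) ≡ ∑ xs f + ∑ xs g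
∑-+ []       f g = refl
∑-+ (x ∷ xs) f g = trans (cong ((f x + g x) +_) (∑-+ xs f g))
                         (interchange ℕP.+-commutativeSemigroup (f x) (g x) (∑ xs f) (∑ xs g))

∑-*ˡ : ∀ (xs : List X) (c : ℕ) (f : X → ℕ) → ∑[ x ∈ xs ] (c * f x) ≡ c * ∑ xs f
∑-*ˡ []       c f = sym (ℕP.*-zeroʳ c)
∑-*ˡ (x ∷ xs) c f = trans (cong (c * f x +_) (∑-*ˡ xs c f)) (sym (ℕP.*-distribˡ-+ c (f x) (∑ xs f)))

∑-*ʳ : ∀ (xs : List X) (c : ℕ) (f : X → ℕ) → ∑[ x ∈ xs ] (f x * c) ≡ ∑ xs f * c
∑-*ʳ xs c f = trans (∑-cong xs (λ x → ℕP.*-comm (f x) c))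
                    (trans (∑-*ˡ xs c f) (ℕP.*-comm c (∑ xs f)))

∑-const : ∀ (xs : List X) (c : ℕ) → ∑[ x ∈ xs ] c ≡ length xs * c
∑-const []       c = refl
∑-const (x ∷ xs) c = cong (c +_) (∑-const xs c)

∑-zero : ∀ (xs : List X) {f : X → ℕ} → (∀ x → f x ≡ 0) → ∑ xs f ≡ 0
∑-zero xs {f} e = trans (∑-cong xs e) (trans (∑-const xs 0) (ℕP.*-zeroʳ (length xs)))

∑-swap : ∀ (xs : List X) (ys : List Y) (f : X → Y → ℕ) →
         ∑[ x ∈ xs ] ∑[ y ∈ ys ] f x y ≡ ∑[ y ∈ ys ] ∑[ x ∈ xs ] f x y
∑-swap []       ys f = sym (∑-zero ys (λ _ → refl))
∑-swap (x ∷ xs) ys f = trans (cong (∑ ys (f x) +_) (∑-swap xs ys f))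
                             (sym (∑-+ ys (f x) (λ y → ∑[ x′ ∈ xs ] f x′ y)))

∑-product : ∀ (xs : List X) (ys : List Y) (f : X → ℕ) (g : Y → ℕ) →
            ∑ xs f * ∑ ys g ≡ ∑[ x ∈ xs ] ∑[ y ∈ ys ] (f x * g y)
∑-product xs ys f g = trans (sym (∑-*ʳ xs (∑ ys g) f))
                            (∑-cong xs (λ x → sym (∑-*ˡ ys (f x) g)))

∑-mono : ∀ (xs : List X) {f g : X → ℕ} → (∀ x → f x ≤ g x) → ∑ xs f ≤ ∑ xs g
∑-mono []       le = z≤n
∑-mono (x ∷ xs) le = ℕP.+-mono-≤ (le x) (∑-mono xs le)

∑-mono-< : ∀ (xs : List X) {f g : X → ℕ} u → u ∈ xs →
           (∀ x → f x ≤ g x) → f u < g u → ∑ xs f < ∑ xs g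
∑-mono-< (x ∷ xs) u (here refl) le lt = ℕP.+-mono-≤ lt (∑-mono xs le)
∑-mono-< (x ∷ xs) {f} {g} u (there u∈xs) le lt =
  subst (_≤ g x + ∑ xs g) (ℕP.+-suc (f x) (∑ xs f))
        (ℕP.+-mono-≤ (le x) (∑-mono-< xs u u∈xs le lt))

∑-weighted-split : ∀ (xs : List X) (w f g : X → ℕ) c →
  ∑[ x ∈ xs ] (w x * (f x + 2 * g x + c)) ≡ ∑[ x ∈ xs ] (w x * f x) + 2 * ∑[ x ∈ xs ] (w x * g x) + ∑ xs w * c
∑-weighted-split xs w f g c = begin
  ∑[ x ∈ xs ] (w x * (f x + 2 * g x + c))
    ≡⟨ ∑-cong xs (λ x → solve 4 (λ w f g c → w :* (f :+ con 2 :* g :+ c) := w :* f :+ con 2 :* (w :* g) :+ w :* c)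
                                 refl (w x) (f x) (g x) c) ⟩
  ∑[ x ∈ xs ] (w x * f x + 2 * (w x * g x) + w x * c)
    ≡⟨ ∑-+ xs _ _ ⟩
  ∑[ x ∈ xs ] (w x * f x + 2 * (w x * g x)) + ∑[ x ∈ xs ] (w x * c)
    ≡⟨ cong₂ _+_ (trans (∑-+ xs _ _) (cong (∑[ x ∈ xs ] (w x * f x) +_) (∑-*ˡ xs 2 _))) (∑-*ʳ xs c w) ⟩
  ∑[ x ∈ xs ] (w x * f x) + 2 * ∑[ x ∈ xs ] (w x * g x) + ∑ xs w * c ∎
  where open ≡-Reasoning
        open +-*-Solver using (solve; _:+_; _:*_; _:=_; con)

∑-allFin-suc : ∀ {m} (f : Fin (suc m) → ℕ) → ∑ (allFin (suc m)) f ≡ f Fin.zero + ∑ (allFin m) (f ∘ Fin.suc)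
∑-allFin-suc {m} f = cong (f Fin.zero +_) (cong sum (trans (LP.map-tabulate Fin.suc f)
                                                          (sym (LP.map-tabulate (λ x → x) (f ∘ Fin.suc)))))

∣∣-as-sum : ∀ {m} (Z : Subset m) → ∣ Z ∣ ≡ ∑[ z ∈ allFin m ] ⟦ lookup Z z ⟧
∣∣-as-sum []                = refl
∣∣-as-sum {suc m} (true ∷ Z)  = trans (cong suc (∣∣-as-sum Z)) (sym (∑-allFin-suc (λ z → ⟦ lookup (true ∷ Z) z ⟧)))
∣∣-as-sum {suc m} (false ∷ Z) = trans (∣∣-as-sum Z) (sym (∑-allFin-suc (λ z → ⟦ lookup (false ∷ Z) z ⟧)))

∑-upTo-suc : ∀ L f → ∑ (upTo (suc L)) f ≡ f 0 + ∑ (upTo L) (f ∘ suc)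
∑-upTo-suc L f = cong (f 0 +_) (cong sum (trans (LP.map-applyUpTo suc f L)
                                               (sym (LP.map-upTo (f ∘ suc) L))))

∑-upTo-cong : ∀ L {f g : ℕ → ℕ} → (∀ i → i < L → f i ≡ g i) → ∑ (upTo L) f ≡ ∑ (upTo L) g
∑-upTo-cong zero    e = refl
∑-upTo-cong (suc L) {f} {g} e = begin
  ∑ (upTo (suc L)) f            ≡⟨ ∑-upTo-suc L f ⟩
  f 0 + ∑ (upTo L) (f ∘ suc)    ≡⟨ cong₂ _+_ (e 0 (s≤s z≤n)) (∑-upTo-cong L (λ i i<L → e (suc i) (s≤s i<L))) ⟩
  g 0 + ∑ (upTo L) (g ∘ suc)    ≡⟨ sym (∑-upTo-suc L g) ⟩
  ∑ (upTo (suc L)) g            ∎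
  where open ≡-Reasoning

∑-upTo-shift : ∀ L (f g : ℕ → ℕ) → (∀ k → f (suc k) ≡ g k) →
               ∑ (upTo (suc L)) f ≡ f 0 + ∑ (upTo L) g
∑-upTo-shift L f g e = trans (∑-upTo-suc L f) (cong (f 0 +_) (∑-upTo-cong L (λ k _ → e k)))

∑-delta : ∀ L a (v : ℕ → ℕ) → a < L → ∑[ i ∈ upTo L ] (⟦ a ≡ᵇ i ⟧ * v i) ≡ v a
∑-delta (suc L) zero v _ = begin
  ∑[ i ∈ upTo (suc L) ] (⟦ 0 ≡ᵇ i ⟧ * v i)  ≡⟨ ∑-upTo-suc L (λ i → ⟦ 0 ≡ᵇ i ⟧ * v i) ⟩
  (v 0 + 0) + ∑[ i ∈ upTo L ] 0             ≡⟨ cong₂ _+_ (ℕP.+-identityʳ (v 0)) (∑-zero (upTo L) (λ _ → refl)) ⟩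
  v 0 + 0                                   ≡⟨ ℕP.+-identityʳ (v 0) ⟩
  v 0                                       ∎
  where open ≡-Reasoning
∑-delta (suc L) (suc a) v (s≤s a<L) =
  trans (∑-upTo-suc L (λ i → ⟦ suc a ≡ᵇ i ⟧ * v i)) (∑-delta L a (v ∘ suc) a<L)

∑-delta₂ : ∀ L a b (F : ℕ → ℕ → ℕ) → a < L → b < L →
           ∑[ i ∈ upTo L ] ∑[ j ∈ upTo L ] (⟦ (a ≡ᵇ i) ∧ (b ≡ᵇ j) ⟧ * F i j) ≡ F a b
∑-delta₂ L a b F a<L b<L = begin
  ∑[ i ∈ upTo L ] ∑[ j ∈ upTo L ] (⟦ (a ≡ᵇ i) ∧ (b ≡ᵇ j) ⟧ * F i j)
    ≡⟨ ∑-cong (upTo L) (λ i → ∑-cong (upTo L) (λ j →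
         trans (cong (_* F i j) (⟦∧⟧ (a ≡ᵇ i) (b ≡ᵇ j))) (ℕP.*-assoc ⟦ a ≡ᵇ i ⟧ _ (F i j)))) ⟩
  ∑[ i ∈ upTo L ] ∑[ j ∈ upTo L ] (⟦ a ≡ᵇ i ⟧ * (⟦ b ≡ᵇ j ⟧ * F i j))
    ≡⟨ ∑-cong (upTo L) (λ i → ∑-*ˡ (upTo L) ⟦ a ≡ᵇ i ⟧ _) ⟩
  ∑[ i ∈ upTo L ] (⟦ a ≡ᵇ i ⟧ * ∑[ j ∈ upTo L ] (⟦ b ≡ᵇ j ⟧ * F i j))
    ≡⟨ ∑-cong (upTo L) (λ i → cong (⟦ a ≡ᵇ i ⟧ *_) (∑-delta L b (F i) b<L)) ⟩
  ∑[ i ∈ upTo L ] (⟦ a ≡ᵇ i ⟧ * F i b)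
    ≡⟨ ∑-delta L a (λ i → F i b) a<L ⟩
  F a b ∎
  where open ≡-Reasoning

∑-by-value : ∀ n (xs : List X) (v : X → ℕ) (b : X → Bool) (f : ℕ → ℕ) → (∀ x → v x ≤ n) →
             ∑[ x ∈ xs ] (⟦ b x ⟧ * f (v x)) ≡ ∑[ k ∈ upTo (suc n) ] (∑[ x ∈ xs ] ⟦ b x ∧ (v x ≡ᵇ k) ⟧ * f k)
∑-by-value n xs v b f v≤n = begin
  ∑[ x ∈ xs ] (⟦ b x ⟧ * f (v x))
    ≡⟨ ∑-cong xs (λ x → cong (⟦ b x ⟧ *_) (sym (∑-delta (suc n) (v x) f (s≤s (v≤n x))))) ⟩
  ∑[ x ∈ xs ] (⟦ b x ⟧ * ∑[ k ∈ D ] (⟦ v x ≡ᵇ k ⟧ * f k))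
    ≡⟨ ∑-cong xs (λ x → sym (∑-*ˡ D ⟦ b x ⟧ _)) ⟩
  ∑[ x ∈ xs ] ∑[ k ∈ D ] (⟦ b x ⟧ * (⟦ v x ≡ᵇ k ⟧ * f k))
    ≡⟨ ∑-swap xs D _ ⟩
  ∑[ k ∈ D ] ∑[ x ∈ xs ] (⟦ b x ⟧ * (⟦ v x ≡ᵇ k ⟧ * f k))
    ≡⟨ ∑-cong D (λ k → ∑-cong xs (λ x → trans (sym (ℕP.*-assoc ⟦ b x ⟧ _ (f k)))
                                              (cong (_* f k) (sym (⟦∧⟧ (b x) (v x ≡ᵇ k)))))) ⟩
  ∑[ k ∈ D ] ∑[ x ∈ xs ] (⟦ b x ∧ (v x ≡ᵇ k) ⟧ * f k)
    ≡⟨ ∑-cong D (λ k → ∑-*ʳ xs (f k) _) ⟩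
  ∑[ k ∈ D ] (∑[ x ∈ xs ] ⟦ b x ∧ (v x ≡ᵇ k) ⟧ * f k) ∎
  where open ≡-Reasoning
        D = upTo (suc n)

≤ᵇ-suc : ∀ b t → (suc b ≤ᵇ suc t) ≡ (b ≤ᵇ t)
≤ᵇ-suc zero    t = refl
≤ᵇ-suc (suc b) t = refl

∑-prefix : ∀ M b (h : ℕ → ℕ) → b < M →
           ∑[ k ∈ upTo M ] (⟦ k ≤ᵇ b ⟧ * h k) ≡ ∑ (upTo (suc b)) h
∑-prefix (suc M) zero h _ = begin
  ∑[ k ∈ upTo (suc M) ] (⟦ k ≤ᵇ 0 ⟧ * h k)  ≡⟨ ∑-upTo-suc M (λ k → ⟦ k ≤ᵇ 0 ⟧ * h k) ⟩
  (h 0 + 0) + ∑[ k ∈ upTo M ] 0             ≡⟨ cong ((h 0 + 0) +_) (∑-zero (upTo M) (λ _ → refl)) ⟩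
  (h 0 + 0) + 0                             ≡⟨ ℕP.+-identityʳ (h 0 + 0) ⟩
  ∑ (upTo 1) h                              ∎
  where open ≡-Reasoning
∑-prefix (suc M) (suc b) h (s≤s b<M) = begin
  ∑[ k ∈ upTo (suc M) ] (⟦ k ≤ᵇ suc b ⟧ * h k)
    ≡⟨ ∑-upTo-shift M (λ k → ⟦ k ≤ᵇ suc b ⟧ * h k) (λ k → ⟦ k ≤ᵇ b ⟧ * h (suc k))
                      (λ k → cong (λ u → ⟦ u ⟧ * h (suc k)) (≤ᵇ-suc k b)) ⟩
  (h 0 + 0) + ∑[ k ∈ upTo M ] (⟦ k ≤ᵇ b ⟧ * h (suc k))
    ≡⟨ cong₂ _+_ (ℕP.+-identityʳ (h 0)) (∑-prefix M b (h ∘ suc) b<M) ⟩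
  h 0 + ∑ (upTo (suc b)) (h ∘ suc)
    ≡⟨ sym (∑-upTo-suc (suc b) h) ⟩
  ∑ (upTo (suc (suc b))) h ∎
  where open ≡-Reasoning

∑-window : ∀ a M b (h : ℕ → ℕ) → b < M →
           ∑[ k ∈ upTo M ] (⟦ a ≤ᵇ k ⟧ * (⟦ k ≤ᵇ b ⟧ * h k)) ≡ sumFromTo a b h
∑-window zero M b h b<M =
  trans (∑-upTo-cong M (λ k _ → ℕP.+-identityʳ (⟦ k ≤ᵇ b ⟧ * h k))) (∑-prefix M b h b<M)
∑-window (suc a) (suc M) zero h _ = begin
  ∑[ k ∈ upTo (suc M) ] (⟦ suc a ≤ᵇ k ⟧ * (⟦ k ≤ᵇ 0 ⟧ * h k))
    ≡⟨ ∑-upTo-suc M (λ k → ⟦ suc a ≤ᵇ k ⟧ * (⟦ k ≤ᵇ 0 ⟧ * h k)) ⟩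
  0 + ∑[ k ∈ upTo M ] (⟦ suc a ≤ᵇ suc k ⟧ * 0)
    ≡⟨ ∑-zero (upTo M) (λ k → ℕP.*-zeroʳ ⟦ suc a ≤ᵇ suc k ⟧) ⟩
  0
    ≡⟨ sym (cong (λ L → ∑[ i ∈ upTo L ] h (suc a + i)) (ℕP.0∸n≡0 a)) ⟩
  sumFromTo (suc a) 0 h ∎
  where open ≡-Reasoning
∑-window (suc a) (suc M) (suc b) h (s≤s b<M) =
  trans (∑-upTo-shift M (λ k → ⟦ suc a ≤ᵇ k ⟧ * (⟦ k ≤ᵇ suc b ⟧ * h k))
                        (λ k → ⟦ a ≤ᵇ k ⟧ * (⟦ k ≤ᵇ b ⟧ * h (suc k)))
                        (λ k → cong₂ (λ u v → ⟦ u ⟧ * (⟦ v ⟧ * h (suc k))) (≤ᵇ-suc a k) (≤ᵇ-suc k b)))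
        (∑-window a M b (h ∘ suc) b<M)

≤ᵇ-⊓ : ∀ k c n → k ≤ n → (k ≤ᵇ c ⊓ n) ≡ (k ≤ᵇ c)
≤ᵇ-⊓ zero    c       n       _         = refl
≤ᵇ-⊓ (suc k) zero    (suc n) _         = refl
≤ᵇ-⊓ (suc k) (suc c) (suc n) (s≤s k≤n) = trans (≤ᵇ-suc k (c ⊓ n)) (trans (≤ᵇ-⊓ k c n k≤n) (sym (≤ᵇ-suc k c)))

∣-∣≤ : ∀ a b k → a ≤ b + k → b ≤ a + k → ∣ a - b ∣ ≤ k
∣-∣≤ zero    b       k _         b≤k       = b≤k
∣-∣≤ (suc a) zero    k a<k       _         = a<k
∣-∣≤ (suc a) (suc b) k (s≤s a≤) (s≤s b≤) = ∣-∣≤ a b k a≤ b≤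

thresholds-above : ∀ n c → c ≤ n → ∑[ t ∈ upTo (suc n) ] ⟦ c ≤ᵇ t ⟧ + c ≡ suc n
thresholds-above n zero _ =
  trans (ℕP.+-identityʳ _) (trans (∑-const (upTo (suc n)) 1)
        (trans (ℕP.*-identityʳ _) (LP.length-upTo (suc n))))
thresholds-above (suc n) (suc c) (s≤s c≤n) = begin
  ∑[ t ∈ upTo (suc (suc n)) ] ⟦ suc c ≤ᵇ t ⟧ + suc c
    ≡⟨ cong (_+ suc c) (∑-upTo-shift (suc n) (λ t → ⟦ suc c ≤ᵇ t ⟧) (λ t → ⟦ c ≤ᵇ t ⟧)
                                     (λ t → cong ⟦_⟧ (≤ᵇ-suc c t))) ⟩
  ∑[ t ∈ upTo (suc n) ] ⟦ c ≤ᵇ t ⟧ + suc c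
    ≡⟨ ℕP.+-suc _ c ⟩
  suc (∑[ t ∈ upTo (suc n) ] ⟦ c ≤ᵇ t ⟧ + c)
    ≡⟨ cong suc (thresholds-above n c c≤n) ⟩
  suc (suc n) ∎
  where open ≡-Reasoning

commonThresholds : ℕ → ℕ → ℕ → ℕ
commonThresholds n a b = ∑[ t ∈ upTo (suc n) ] (⟦ a ≤ᵇ t ⟧ * ⟦ b ≤ᵇ t ⟧)

-- The pointwise identity behind the theorem: since commonThresholds n a b
-- = n + 1 − max a b and ∣ a − b ∣ + a + b = 2 max a b, for a, b ≤ n
--   ∣ a − b ∣ + 2 · commonThresholds n a b + (a + b) = 2 (n + 1).
threshold-identity : ∀ n a b → a ≤ n → b ≤ n →
                     ∣ a - b ∣ + 2 * commonThresholds n a b + (a + b) ≡ 2 * suc n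
threshold-identity n zero b _ b≤n = begin
  b + 2 * commonThresholds n 0 b + b
    ≡⟨ cong (λ z → b + 2 * z + b) (∑-upTo-cong (suc n) (λ t _ → ℕP.+-identityʳ ⟦ b ≤ᵇ t ⟧)) ⟩
  b + 2 * above + b
    ≡⟨ solve 2 (λ b r → b :+ con 2 :* r :+ b := con 2 :* (r :+ b)) refl b above ⟩
  2 * (above + b)
    ≡⟨ cong (2 *_) (thresholds-above n b b≤n) ⟩
  2 * suc n ∎
  where open ≡-Reasoning
        open +-*-Solver using (solve; _:+_; _:*_; _:=_; con)
        above = ∑[ t ∈ upTo (suc n) ] ⟦ b ≤ᵇ t ⟧
threshold-identity n (suc a) zero a<n _ = begin
  suc a + 2 * commonThresholds n (suc a) 0 + (suc a + 0)
    ≡⟨ cong (λ z → suc a + 2 * z + (suc a + 0)) (∑-upTo-cong (suc n) (λ t _ → ℕP.*-identityʳ ⟦ suc a ≤ᵇ t ⟧)) ⟩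
  suc a + 2 * above + (suc a + 0)
    ≡⟨ solve 2 (λ b r → b :+ con 2 :* r :+ (b :+ con 0) := con 2 :* (r :+ b)) refl (suc a) above ⟩
  2 * (above + suc a)
    ≡⟨ cong (2 *_) (thresholds-above n (suc a) a<n) ⟩
  2 * suc n ∎
  where open ≡-Reasoning
        open +-*-Solver using (solve; _:+_; _:*_; _:=_; con)
        above = ∑[ t ∈ upTo (suc n) ] ⟦ suc a ≤ᵇ t ⟧
threshold-identity (suc n) (suc a) (suc b) (s≤s a≤n) (s≤s b≤n) = begin
  ∣ a - b ∣ + 2 * commonThresholds (suc n) (suc a) (suc b) + (suc a + suc b)
    ≡⟨ cong (λ z → ∣ a - b ∣ + 2 * z + (suc a + suc b))
            (∑-upTo-shift (suc n) (λ t → ⟦ suc a ≤ᵇ t ⟧ * ⟦ suc b ≤ᵇ t ⟧) (λ t → ⟦ a ≤ᵇ t ⟧ * ⟦ b ≤ᵇ t ⟧)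
                          (λ t → cong₂ (λ u v → ⟦ u ⟧ * ⟦ v ⟧) (≤ᵇ-suc a t) (≤ᵇ-suc b t))) ⟩
  ∣ a - b ∣ + 2 * common + (suc a + suc b)
    ≡⟨ solve 4 (λ d r a b → d :+ con 2 :* r :+ (con 1 :+ a :+ (con 1 :+ b))
                            := (d :+ con 2 :* r :+ (a :+ b)) :+ con 2) refl ∣ a - b ∣ common a b ⟩
  (∣ a - b ∣ + 2 * common + (a + b)) + 2
    ≡⟨ cong (_+ 2) (threshold-identity n a b a≤n b≤n) ⟩
  2 * suc n + 2
    ≡⟨ solve 1 (λ n → con 2 :* (con 1 :+ n) :+ con 2 := con 2 :* (con 2 :+ n)) refl n ⟩
  2 * suc (suc n) ∎
  where open ≡-Reasoning
        open +-*-Solver using (solve; _:+_; _:*_; _:=_; con)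
        common = commonThresholds n a b

module GraphMetric {m : ℕ} (G : SimpleGraph m) where
  open SimpleGraph G using (adj) renaming (sym to adj-sym)

  -- x and y are joined by a walk of length at most ℓ.  (A record rather than
  -- T (within G ℓ x y) itself, so that ℓ, x and y can be inferred.)
  record Walk≤ (ℓ : ℕ) (x y : Fin m) : Set where
    constructor walk
    field holds : T (within G ℓ x y)
  open Walk≤

  walk-suc : ∀ {ℓ x y} → Walk≤ ℓ x y → Walk≤ (suc ℓ) x y
  walk-suc (walk w) = walk (Equivalence.from T-∨ (inj₁ w))

  walk-mono : ∀ {ℓ ℓ′ x y} → ℓ ≤ ℓ′ → Walk≤ ℓ x y → Walk≤ ℓ′ x y
  walk-mono ℓ≤ℓ′ w with ℕP.≤⇒≤′ ℓ≤ℓ′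
  ... | ℕ.≤′-refl       = w
  ... | ℕ.≤′-step ℓ≤′k = walk-suc (walk-mono (ℕP.≤′⇒≤ ℓ≤′k) w)

  walk-zero : ∀ {x y} → Walk≤ 0 x y → x ≡ y
  walk-zero (walk w) = toWitness w

  walk-refl : ∀ ℓ x → Walk≤ ℓ x x
  walk-refl ℓ x = walk-mono z≤n (walk (fromWitness refl))

  walk-cons : ∀ {ℓ x z y} → T (adj x z) → Walk≤ ℓ z y → Walk≤ (suc ℓ) x y
  walk-cons {z = z} e (walk w) =
    walk (Equivalence.from T-∨ (inj₂ (any⁺ _ (lose (∈-allFin z) (Equivalence.from T-∧ (e , w))))))

  walk-uncons : ∀ {ℓ x y} → Walk≤ (suc ℓ) x y → Walk≤ ℓ x y ⊎ ∃[ z ] (T (adj x z) × Walk≤ ℓ z y)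
  walk-uncons (walk w) with Equivalence.to T-∨ w
  ... | inj₁ w′ = inj₁ (walk w′)
  ... | inj₂ p with satisfied (any⁻ _ (allFin m) p)
  ...   | z , q with Equivalence.to T-∧ q
  ...     | e , w′ = inj₂ (z , e , walk w′)

  walk-trans : ∀ a {b x y z} → Walk≤ a x y → Walk≤ b y z → Walk≤ (a + b) x z
  walk-trans zero    w₁ w₂ rewrite walk-zero w₁ = w₂
  walk-trans (suc a) w₁ w₂ with walk-uncons w₁
  ... | inj₁ w           = walk-suc (walk-trans a w w₂)
  ... | inj₂ (_ , e , w) = walk-cons e (walk-trans a w w₂)

  walk-snoc : ∀ {ℓ x v y} → Walk≤ ℓ x v → T (adj v y) → Walk≤ (suc ℓ) x y
  walk-snoc {ℓ} {x} {v} {y} w e =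
    subst (λ k → Walk≤ k x y) (ℕP.+-comm ℓ 1) (walk-trans ℓ w (walk-cons e (walk-refl 0 y)))

  walk-sym : ∀ ℓ {x y} → Walk≤ ℓ x y → Walk≤ ℓ y x
  walk-sym zero    w rewrite walk-zero w = walk-refl 0 _
  walk-sym (suc ℓ) w with walk-uncons w
  ... | inj₁ w′           = walk-suc (walk-sym ℓ w′)
  ... | inj₂ (z , e , w′) = walk-snoc (walk-sym ℓ w′) (subst T (adj-sym _ z) e)

  walk? : ∀ ℓ x y → Dec (Walk≤ ℓ x y)
  walk? ℓ x y = map′ walk holds (T? (within G ℓ x y))

  ballSize : ℕ → Fin m → ℕ
  ballSize s x = ∑[ u ∈ allFin m ] ⟦ within G s x u ⟧

  ball-grows : ∀ s x ℓ y → Walk≤ ℓ y x → ¬ Walk≤ s x y →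
               ∃[ u ] (Walk≤ (suc s) x u × ¬ Walk≤ s x u)
  ball-grows s x zero    y w y∉ = contradiction (subst (Walk≤ s x) (sym (walk-zero w)) (walk-refl s x)) y∉
  ball-grows s x (suc ℓ) y w y∉ with walk-uncons w
  ... | inj₁ w′ = ball-grows s x ℓ y w′ y∉
  ... | inj₂ (v , e , w′) with walk? s x v
  ...   | yes v∈ = y , walk-snoc v∈ (subst T (adj-sym y v) e) , y∉
  ...   | no  v∉ = ball-grows s x ℓ v w′ v∉

  ball-lower-bound : ∀ x y ℓ → Walk≤ ℓ y x → ∀ s → Walk≤ s x y ⊎ s < ballSize s x
  ball-lower-bound x y ℓ w zero with walk? 0 x y
  ... | yes w₀ = inj₁ w₀
  ... | no  _  = inj₂ (subst (_< ballSize 0 x) (∑-zero (allFin m) (λ _ → refl))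
                   (∑-mono-< (allFin m) x (∈-allFin x) (λ _ → z≤n) (⟦⟧-< {false} (λ ()) (holds (walk-refl 0 x)))))
  ball-lower-bound x y ℓ w (suc s) with walk? (suc s) x y
  ... | yes w′ = inj₁ w′
  ... | no y∉ with ball-lower-bound x y ℓ w s
  ...   | inj₁ w′ = contradiction (walk-suc w′) y∉
  ...   | inj₂ s<size with ball-grows s x ℓ y w (λ w′ → y∉ (walk-suc w′))
  ...     | u , u∈ , u∉ = inj₂ (ℕP.≤-trans (s≤s s<size)
              (∑-mono-< (allFin m) u (∈-allFin u) (λ v → ⟦⟧-mono {within G s x v} (λ w → holds (walk-suc {s} {x} {v} (walk w))))
                        (⟦⟧-< (λ t → u∉ (walk t)) (holds u∈))))

  ball-upper-bound : ∀ s x y → ¬ Walk≤ s x y → ballSize s x < m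
  ball-upper-bound s x y y∉ =
    subst (ballSize s x <_) (trans (∑-const (allFin m) 1) (trans (ℕP.*-identityʳ _) (LP.length-tabulate (λ z → z))))
          (∑-mono-< (allFin m) y (∈-allFin y) (λ v → ⟦⟧≤1 (within G s x v)) (⟦⟧-< {b = true} (λ t → y∉ (walk t)) _))

  short-walk : ∀ x y ℓ → Walk≤ ℓ y x → Walk≤ (ℕ.pred m) x y
  short-walk x y ℓ w with walk? (ℕ.pred m) x y
  ... | yes w′ = w′
  ... | no y∉ with ball-lower-bound x y ℓ w (ℕ.pred m)
  ...   | inj₁ w′ = contradiction w′ y∉
  ...   | inj₂ lt = ⊥-elim (nothing-between lt (ball-upper-bound (ℕ.pred m) x y y∉))
    where
      nothing-between : ∀ {n k} → ℕ.pred n < k → k < n → ⊥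
      nothing-between {suc n} lt k<n = ℕP.<-irrefl refl (ℕP.<-≤-trans lt (ℕP.≤-pred k<n))

  search-step : ∀ {s ℓ x y} → within G s x y ≡ false → Walk≤ ℓ x y → s ≤ ℓ → s < ℓ
  search-step fails w s≤ℓ = ℕP.≤∧≢⇒< s≤ℓ (λ { refl → subst T fails (holds w) })

  search-minimal : ∀ s f x y ℓ → s ≤ ℓ → Walk≤ ℓ x y → distSearch G s f x y ≤ ℓ
  search-minimal s zero    x y ℓ s≤ℓ w = s≤ℓ
  search-minimal s (suc f) x y ℓ s≤ℓ w with within G s x y in eq
  ... | true  = s≤ℓ
  ... | false = search-minimal (suc s) f x y ℓ (search-step eq w s≤ℓ) w

  search-sound : ∀ s f x y ℓ → s ≤ ℓ → ℓ < s + f → Walk≤ ℓ x y → Walk≤ (distSearch G s f x y) x y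
  search-sound s zero    x y ℓ s≤ℓ lt w = contradiction s≤ℓ (ℕP.<⇒≱ (subst (ℓ <_) (ℕP.+-identityʳ s) lt))
  search-sound s (suc f) x y ℓ s≤ℓ lt w with within G s x y in eq
  ... | true  = walk (subst T (sym eq) _)
  ... | false = search-sound (suc s) f x y ℓ (search-step eq w s≤ℓ) (subst (ℓ <_) (ℕP.+-suc s f) lt) w

  dist-minimal : ∀ ℓ {x y} → Walk≤ ℓ x y → dist G x y ≤ ℓ
  dist-minimal ℓ {x} {y} = search-minimal 0 m x y ℓ z≤n

  module _ (connected : Connected G) where

    dist-walk : ∀ x y → Walk≤ (dist G x y) x y
    dist-walk x y with connected y x
    ... | ℓ , w = search-sound 0 m x y (ℕ.pred m) z≤n (pred< x) (short-walk x y ℓ (walk w))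
      where pred< : ∀ {k} → Fin k → ℕ.pred k < k
            pred< {suc _} _ = ℕP.≤-refl

    dist-sym : ∀ x y → dist G x y ≡ dist G y x
    dist-sym x y = ℕP.≤-antisym (dist-minimal _ (walk-sym _ (dist-walk y x)))
                                (dist-minimal _ (walk-sym _ (dist-walk x y)))

    dist-triangle : ∀ x y z → dist G x z ≤ dist G x y + dist G y z
    dist-triangle x y z = dist-minimal _ (walk-trans (dist G x y) (dist-walk x y) (dist-walk y z))

ι : ℕ → ℚ
ι a = frac a 1

module _ where
  open ℤ using (+_)
  open ℚᵘP.≃-Reasoning
  open ℤSolver.+-*-Solver using (solve; _:+_; _:*_; _:=_; con)

  private
    frac-unnormalised : ∀ a b → toℚᵘ (frac a (suc b)) ℚᵘ.≃ mkℚᵘ (+ a) b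
    frac-unnormalised a b = toℚᵘ-fromℚᵘ (mkℚᵘ (+ a) b)

  ι-+ : ∀ a b → ι (a ℕ.+ b) ≡ ι a ℚ.+ ι b
  ι-+ a b = toℚᵘ-injective (begin
    toℚᵘ (ι (a ℕ.+ b))             ≈⟨ frac-unnormalised (a ℕ.+ b) 0 ⟩
    mkℚᵘ (+ (a ℕ.+ b)) 0            ≈⟨ *≡* (trans (cong (ℤ._* + 1) (pos-+ a b))
                                             (solve 2 (λ x y → (x :+ y) :* con (+ 1) := (x :* con (+ 1) :+ y :* con (+ 1)) :* con (+ 1))
                                                    refl (+ a) (+ b))) ⟩
    mkℚᵘ (+ a) 0 ℚᵘ.+ mkℚᵘ (+ b) 0  ≈⟨ ℚᵘP.+-cong (ℚᵘP.≃-sym (frac-unnormalised a 0)) (ℚᵘP.≃-sym (frac-unnormalised b 0)) ⟩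
    toℚᵘ (ι a) ℚᵘ.+ toℚᵘ (ι b)      ≈⟨ ℚᵘP.≃-sym (toℚᵘ-homo-+ (ι a) (ι b)) ⟩
    toℚᵘ (ι a ℚ.+ ι b)              ∎)

  ι-* : ∀ a b → ι (a ℕ.* b) ≡ ι a ℚ.* ι b
  ι-* a b = toℚᵘ-injective (begin
    toℚᵘ (ι (a ℕ.* b))             ≈⟨ frac-unnormalised (a ℕ.* b) 0 ⟩
    mkℚᵘ (+ (a ℕ.* b)) 0            ≈⟨ *≡* (cong (ℤ._* + 1) (pos-* a b)) ⟩
    mkℚᵘ (+ a) 0 ℚᵘ.* mkℚᵘ (+ b) 0  ≈⟨ ℚᵘP.*-cong (ℚᵘP.≃-sym (frac-unnormalised a 0)) (ℚᵘP.≃-sym (frac-unnormalised b 0)) ⟩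
    toℚᵘ (ι a) ℚᵘ.* toℚᵘ (ι b)      ≈⟨ ℚᵘP.≃-sym (toℚᵘ-homo-* (ι a) (ι b)) ⟩
    toℚᵘ (ι a ℚ.* ι b)              ∎)

  frac-split : ∀ a b → 0 ℕ.< b → frac a b ≡ ι a ℚ.* frac 1 b
  frac-split a (suc b) _ = toℚᵘ-injective (begin
    toℚᵘ (frac a (suc b))                 ≈⟨ frac-unnormalised a b ⟩
    mkℚᵘ (+ a) b                          ≈⟨ *≡* (trans (cong (λ z → + a ℤ.* + z) (ℕP.*-identityˡ (suc b)))
                                                        (cong (ℤ._* + suc b) (sym (ℤP.*-identityʳ (+ a))))) ⟩
    mkℚᵘ (+ a) 0 ℚᵘ.* mkℚᵘ (+ 1) b        ≈⟨ ℚᵘP.*-cong (ℚᵘP.≃-sym (frac-unnormalised a 0)) (ℚᵘP.≃-sym (frac-unnormalised 1 b)) ⟩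
    toℚᵘ (ι a) ℚᵘ.* toℚᵘ (frac 1 (suc b)) ≈⟨ ℚᵘP.≃-sym (toℚᵘ-homo-* (ι a) _) ⟩
    toℚᵘ (ι a ℚ.* frac 1 (suc b))         ∎)

  frac-inverse : ∀ b → 0 ℕ.< b → frac 1 b ℚ.* ι b ≡ 1ℚ
  frac-inverse (suc b) _ = toℚᵘ-injective (begin
    toℚᵘ (frac 1 (suc b) ℚ.* ι (suc b))           ≈⟨ toℚᵘ-homo-* (frac 1 (suc b)) _ ⟩
    toℚᵘ (frac 1 (suc b)) ℚᵘ.* toℚᵘ (ι (suc b))   ≈⟨ ℚᵘP.*-cong (frac-unnormalised 1 b) (frac-unnormalised (suc b) 0) ⟩
    mkℚᵘ (+ 1) b ℚᵘ.* mkℚᵘ (+ suc b) 0            ≈⟨ *≡* (solve 1 (λ y → (con (+ 1) :* y) :* con (+ 1) := con (+ 1) :* (y :* con (+ 1)))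
                                                               refl (+ suc b)) ⟩
    mkℚᵘ (+ 1) 0                                  ∎)

∑ℚ : List X → (X → ℚ) → ℚ
∑ℚ xs f = sumℚ (map f xs)

∑ℚ-cong : ∀ (xs : List X) {f g : X → ℚ} → (∀ x → f x ≡ g x) → ∑ℚ xs f ≡ ∑ℚ xs g
∑ℚ-cong []       e = refl
∑ℚ-cong (x ∷ xs) e = cong₂ ℚ._+_ (e x) (∑ℚ-cong xs e)

module _ where
  open ℚSolver.+-*-Solver using (solve; _:+_; _:*_; _:-_; _:=_; con)
  open ≡-Reasoning

  ∑ℚ-scale : ∀ (xs : List X) (f : X → ℕ) c → ∑ℚ xs (λ x → ι (f x) ℚ.* c) ≡ ι (∑ xs f) ℚ.* c
  ∑ℚ-scale []       f c = sym (ℚP.*-zeroˡ c)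
  ∑ℚ-scale (x ∷ xs) f c = begin
    ι (f x) ℚ.* c ℚ.+ ∑ℚ xs (λ y → ι (f y) ℚ.* c)  ≡⟨ cong (ι (f x) ℚ.* c ℚ.+_) (∑ℚ-scale xs f c) ⟩
    ι (f x) ℚ.* c ℚ.+ ι (∑ xs f) ℚ.* c             ≡⟨ sym (ℚP.*-distribʳ-+ c (ι (f x)) (ι (∑ xs f))) ⟩
    (ι (f x) ℚ.+ ι (∑ xs f)) ℚ.* c                 ≡⟨ cong (ℚ._* c) (sym (ι-+ (f x) (∑ xs f))) ⟩
    ι (∑ (x ∷ xs) f) ℚ.* c                         ∎

  ∑ℚ-difference : ∀ (xs : List X) (f g : X → ℕ) c e →
                  ∑ℚ xs (λ x → ι (f x) ℚ.* c ℚ.- ι (g x) ℚ.* e) ≡ ι (∑ xs f) ℚ.* c ℚ.- ι (∑ xs g) ℚ.* e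
  ∑ℚ-difference []       f g c e = solve 2 (λ c e → con 0ℚ := con (ι 0) :* c :- con (ι 0) :* e) refl c e
  ∑ℚ-difference (x ∷ xs) f g c e = begin
    ι (f x) ℚ.* c ℚ.- ι (g x) ℚ.* e ℚ.+ ∑ℚ xs (λ y → ι (f y) ℚ.* c ℚ.- ι (g y) ℚ.* e)
      ≡⟨ cong (ι (f x) ℚ.* c ℚ.- ι (g x) ℚ.* e ℚ.+_) (∑ℚ-difference xs f g c e) ⟩
    ι (f x) ℚ.* c ℚ.- ι (g x) ℚ.* e ℚ.+ (ι (∑ xs f) ℚ.* c ℚ.- ι (∑ xs g) ℚ.* e)
      ≡⟨ solve 6 (λ a b s t c e → a :* c :- b :* e :+ (s :* c :- t :* e) := (a :+ s) :* c :- (b :+ t) :* e)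
               refl (ι (f x)) (ι (g x)) (ι (∑ xs f)) (ι (∑ xs g)) c e ⟩
    (ι (f x) ℚ.+ ι (∑ xs f)) ℚ.* c ℚ.- (ι (g x) ℚ.+ ι (∑ xs g)) ℚ.* e
      ≡⟨ sym (cong₂ (λ u v → u ℚ.* c ℚ.- v ℚ.* e) (ι-+ (f x) (∑ xs f)) (ι-+ (g x) (∑ xs g))) ⟩
    ι (∑ (x ∷ xs) f) ℚ.* c ℚ.- ι (∑ (x ∷ xs) g) ℚ.* e ∎

  ∑ℚ-square : ∀ (xs : List X) (a : X → ℕ) α γ →
              ∑ℚ xs (λ x → (ι (a x) ℚ.* α ℚ.- γ) ℚ.* (ι (a x) ℚ.* α ℚ.- γ))
                ≡ ι (∑[ x ∈ xs ] (a x ℕ.* a x)) ℚ.* (α ℚ.* α) ℚ.- ι (∑ xs a) ℚ.* (ι 2 ℚ.* α ℚ.* γ)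
                    ℚ.+ ι (length xs) ℚ.* (γ ℚ.* γ)
  ∑ℚ-square [] a α γ =
    solve 2 (λ α γ → con 0ℚ := con (ι 0) :* (α :* α) :- con (ι 0) :* (con (ι 2) :* α :* γ) :+ con (ι 0) :* (γ :* γ))
          refl α γ
  ∑ℚ-square (x ∷ xs) a α γ = begin
    (u ℚ.* α ℚ.- γ) ℚ.* (u ℚ.* α ℚ.- γ) ℚ.+ ∑ℚ xs (λ y → (ι (a y) ℚ.* α ℚ.- γ) ℚ.* (ι (a y) ℚ.* α ℚ.- γ))
      ≡⟨ cong ((u ℚ.* α ℚ.- γ) ℚ.* (u ℚ.* α ℚ.- γ) ℚ.+_) (∑ℚ-square xs a α γ) ⟩
    (u ℚ.* α ℚ.- γ) ℚ.* (u ℚ.* α ℚ.- γ) ℚ.+ (ι q ℚ.* (α ℚ.* α) ℚ.- ι s ℚ.* (ι 2 ℚ.* α ℚ.* γ) ℚ.+ ι l ℚ.* (γ ℚ.* γ))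
      ≡⟨ solve 6 (λ u q s l α γ → (u :* α :- γ) :* (u :* α :- γ) :+ (q :* (α :* α) :- s :* (con (ι 2) :* α :* γ) :+ l :* (γ :* γ))
                             := (u :* u :+ q) :* (α :* α) :- (u :+ s) :* (con (ι 2) :* α :* γ) :+ (con 1ℚ :+ l) :* (γ :* γ))
               refl u (ι q) (ι s) (ι l) α γ ⟩
    (u ℚ.* u ℚ.+ ι q) ℚ.* (α ℚ.* α) ℚ.- (u ℚ.+ ι s) ℚ.* (ι 2 ℚ.* α ℚ.* γ) ℚ.+ (1ℚ ℚ.+ ι l) ℚ.* (γ ℚ.* γ)
      ≡⟨ sym (cong₃ (λ Q S L → Q ℚ.* (α ℚ.* α) ℚ.- S ℚ.* (ι 2 ℚ.* α ℚ.* γ) ℚ.+ L ℚ.* (γ ℚ.* γ))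
                    (trans (ι-+ (a x ℕ.* a x) q) (cong (ℚ._+ ι q) (ι-* (a x) (a x))))
                    (ι-+ (a x) s) (ι-+ 1 l)) ⟩
    ι (∑[ y ∈ x ∷ xs ] (a y ℕ.* a y)) ℚ.* (α ℚ.* α) ℚ.- ι (∑ (x ∷ xs) a) ℚ.* (ι 2 ℚ.* α ℚ.* γ)
      ℚ.+ ι (length (x ∷ xs)) ℚ.* (γ ℚ.* γ) ∎
    where
      u = ι (a x)
      q = ∑[ y ∈ xs ] (a y ℕ.* a y)
      s = ∑ xs a
      l = length xs
      cong₃ : ∀ {A B C D : Set} (f : A → B → C → D) {a a′ b b′ c c′} → a ≡ a′ → b ≡ b′ → c ≡ c′ → f a b c ≡ f a′ b′ c′
      cong₃ f refl refl refl = refl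

  mean-square : ∀ (xs : List X) (a : X → ℕ) (N M β : ℕ) α μ → α ℚ.* ι N ≡ 1ℚ → μ ℚ.* ι M ≡ 1ℚ →
                ∑ xs a ≡ N ℕ.* β → length xs ≡ M →
                ∑ℚ xs (λ x → (ι (a x) ℚ.* α ℚ.- ι β ℚ.* μ) ℚ.* (ι (a x) ℚ.* α ℚ.- ι β ℚ.* μ))
                  ≡ ι (∑[ x ∈ xs ] (a x ℕ.* a x)) ℚ.* (α ℚ.* α) ℚ.- ι (β ℕ.* β) ℚ.* μ
  mean-square xs a N M β α μ αN≡1 μM≡1 sum≡ length≡ = begin
    ∑ℚ xs (λ x → (ι (a x) ℚ.* α ℚ.- γ) ℚ.* (ι (a x) ℚ.* α ℚ.- γ))
      ≡⟨ ∑ℚ-square xs a α γ ⟩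
    ι Q ℚ.* (α ℚ.* α) ℚ.- ι (∑ xs a) ℚ.* (ι 2 ℚ.* α ℚ.* γ) ℚ.+ ι (length xs) ℚ.* (γ ℚ.* γ)
      ≡⟨ cong₂ (λ s l → ι Q ℚ.* (α ℚ.* α) ℚ.- s ℚ.* (ι 2 ℚ.* α ℚ.* γ) ℚ.+ ι l ℚ.* (γ ℚ.* γ))
               (trans (cong ι sum≡) (ι-* N β)) length≡ ⟩
    ι Q ℚ.* (α ℚ.* α) ℚ.- ι N ℚ.* ι β ℚ.* (ι 2 ℚ.* α ℚ.* γ) ℚ.+ ι M ℚ.* (γ ℚ.* γ)
      ≡⟨ solve 6 (λ q n mm b α μ → q :* (α :* α) :- n :* b :* (con (ι 2) :* α :* (b :* μ)) :+ mm :* ((b :* μ) :* (b :* μ))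
                                 := q :* (α :* α) :- con (ι 2) :* (α :* n) :* (b :* b :* μ) :+ (μ :* mm) :* (b :* b :* μ))
               refl (ι Q) (ι N) (ι M) (ι β) α μ ⟩
    ι Q ℚ.* (α ℚ.* α) ℚ.- ι 2 ℚ.* (α ℚ.* ι N) ℚ.* (ι β ℚ.* ι β ℚ.* μ) ℚ.+ (μ ℚ.* ι M) ℚ.* (ι β ℚ.* ι β ℚ.* μ)
      ≡⟨ cong₂ (λ u v → ι Q ℚ.* (α ℚ.* α) ℚ.- ι 2 ℚ.* u ℚ.* (ι β ℚ.* ι β ℚ.* μ) ℚ.+ v ℚ.* (ι β ℚ.* ι β ℚ.* μ)) αN≡1 μM≡1 ⟩
    ι Q ℚ.* (α ℚ.* α) ℚ.- ι 2 ℚ.* 1ℚ ℚ.* (ι β ℚ.* ι β ℚ.* μ) ℚ.+ 1ℚ ℚ.* (ι β ℚ.* ι β ℚ.* μ)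
      ≡⟨ solve 4 (λ q b α μ → q :* (α :* α) :- con (ι 2) :* con 1ℚ :* (b :* b :* μ) :+ con 1ℚ :* (b :* b :* μ)
                            := q :* (α :* α) :- b :* b :* μ) refl (ι Q) (ι β) α μ ⟩
    ι Q ℚ.* (α ℚ.* α) ℚ.- ι β ℚ.* ι β ℚ.* μ
      ≡⟨ cong (λ z → ι Q ℚ.* (α ℚ.* α) ℚ.- z ℚ.* μ) (sym (ι-* β β)) ⟩
    ι Q ℚ.* (α ℚ.* α) ℚ.- ι (β ℕ.* β) ℚ.* μ ∎
    where
      γ = ι β ℚ.* μ
      Q = ∑[ x ∈ xs ] (a x ℕ.* a x)

  halve : ∀ a b w s c → a ℕ.+ 2 ℕ.* b ℕ.+ w ℕ.* (2 ℕ.* s) ≡ w ℕ.* (2 ℕ.* c) →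
          ι b ℚ.+ ½ ℚ.* ι a ≡ ι w ℚ.* (ι c ℚ.- ι s)
  halve a b w s c eq = begin
    ι b ℚ.+ ½ ℚ.* ι a
      ≡⟨ solve 4 (λ a b w s → b :+ con ½ :* a := con ½ :* (a :+ con (ι 2) :* b :+ w :* (con (ι 2) :* s)) :- w :* s)
               refl (ι a) (ι b) (ι w) (ι s) ⟩
    ½ ℚ.* (ι a ℚ.+ ι 2 ℚ.* ι b ℚ.+ ι w ℚ.* (ι 2 ℚ.* ι s)) ℚ.- ι w ℚ.* ι s
      ≡⟨ cong (λ z → ½ ℚ.* z ℚ.- ι w ℚ.* ι s) (sym lhs-in-ℚ) ⟩
    ½ ℚ.* ι (a ℕ.+ 2 ℕ.* b ℕ.+ w ℕ.* (2 ℕ.* s)) ℚ.- ι w ℚ.* ι s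
      ≡⟨ cong (λ z → ½ ℚ.* ι z ℚ.- ι w ℚ.* ι s) eq ⟩
    ½ ℚ.* ι (w ℕ.* (2 ℕ.* c)) ℚ.- ι w ℚ.* ι s
      ≡⟨ cong (λ z → ½ ℚ.* z ℚ.- ι w ℚ.* ι s) (trans (ι-* w (2 ℕ.* c)) (cong (ι w ℚ.*_) (ι-* 2 c))) ⟩
    ½ ℚ.* (ι w ℚ.* (ι 2 ℚ.* ι c)) ℚ.- ι w ℚ.* ι s
      ≡⟨ solve 3 (λ w c s → con ½ :* (w :* (con (ι 2) :* c)) :- w :* s := w :* (c :- s)) refl (ι w) (ι c) (ι s) ⟩
    ι w ℚ.* (ι c ℚ.- ι s) ∎
    where
      lhs-in-ℚ : ι (a ℕ.+ 2 ℕ.* b ℕ.+ w ℕ.* (2 ℕ.* s)) ≡ ι a ℚ.+ ι 2 ℚ.* ι b ℚ.+ ι w ℚ.* (ι 2 ℚ.* ι s)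
      lhs-in-ℚ = trans (ι-+ (a ℕ.+ 2 ℕ.* b) (w ℕ.* (2 ℕ.* s)))
                       (cong₂ ℚ._+_ (trans (ι-+ a (2 ℕ.* b)) (cong (ι a ℚ.+_) (ι-* 2 b)))
                                    (trans (ι-* w (2 ℕ.* s)) (cong (ι w ℚ.*_) (ι-* 2 s))))

  combine : ∀ (F B S Q N M : ℕ) (r α μ : ℚ) → α ℚ.* ι N ≡ 1ℚ → μ ℚ.* ι M ≡ 1ℚ →
            ι B ℚ.+ ½ ℚ.* ι F ≡ ι M ℚ.* r → ι Q ℚ.+ ½ ℚ.* ι S ≡ ι (N ℕ.* N) ℚ.* r →
            ι Q ℚ.* (α ℚ.* α) ℚ.- ι B ℚ.* μ ≡ ½ ℚ.* (ι F ℚ.* μ ℚ.- α ℚ.* (ι S ℚ.* α))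
  combine F B S Q N M r α μ αN≡1 μM≡1 vertex-eq pair-eq = begin
    ι Q ℚ.* (α ℚ.* α) ℚ.- ι B ℚ.* μ
      ≡⟨ solve 6 (λ f b x q α μ → q :* (α :* α) :- b :* μ
                                := (q :+ con ½ :* x) :* (α :* α) :- (b :+ con ½ :* f) :* μ :+ con ½ :* (f :* μ :- α :* (x :* α)))
               refl (ι F) (ι B) (ι S) (ι Q) α μ ⟩
    (ι Q ℚ.+ ½ ℚ.* ι S) ℚ.* (α ℚ.* α) ℚ.- (ι B ℚ.+ ½ ℚ.* ι F) ℚ.* μ ℚ.+ rest
      ≡⟨ cong₂ (λ u v → u ℚ.* (α ℚ.* α) ℚ.- v ℚ.* μ ℚ.+ rest) (trans pair-eq (cong (ℚ._* r) (ι-* N N))) vertex-eq ⟩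
    ι N ℚ.* ι N ℚ.* r ℚ.* (α ℚ.* α) ℚ.- ι M ℚ.* r ℚ.* μ ℚ.+ rest
      ≡⟨ solve 6 (λ n mm r α μ h → n :* n :* r :* (α :* α) :- mm :* r :* μ :+ h
                                 := (α :* n) :* (α :* n) :* r :- (μ :* mm) :* r :+ h)
               refl (ι N) (ι M) r α μ rest ⟩
    (α ℚ.* ι N) ℚ.* (α ℚ.* ι N) ℚ.* r ℚ.- (μ ℚ.* ι M) ℚ.* r ℚ.+ rest
      ≡⟨ cong₂ (λ u v → u ℚ.* u ℚ.* r ℚ.- v ℚ.* r ℚ.+ rest) αN≡1 μM≡1 ⟩
    1ℚ ℚ.* 1ℚ ℚ.* r ℚ.- 1ℚ ℚ.* r ℚ.+ rest
      ≡⟨ solve 2 (λ r h → con 1ℚ :* con 1ℚ :* r :- con 1ℚ :* r :+ h := h) refl r rest ⟩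
    rest ∎
    where rest = ½ ℚ.* (ι F ℚ.* μ ℚ.- α ℚ.* (ι S ℚ.* α))

  ι-regroup : ∀ a b α → ι a ℚ.* α ℚ.* ι b ≡ ι (a ℕ.* b) ℚ.* α
  ι-regroup a b α = trans (solve 3 (λ x y z → x :* z :* y := x :* y :* z) refl (ι a) (ι b) α)
                          (cong (ℚ._* α) (sym (ι-* a b)))

-- Counting in a distance-regular graph with intersection numbers p and
-- valencies nv: every count below depends on the vertices involved only
-- through their mutual distances.
module DistanceRegularCounting {m : ℕ} (G : SimpleGraph m) (n : ℕ) (p : ℕ → ℕ → ℕ → ℕ) (nv : ℕ → ℕ)
                               (DR : IsDistanceRegular G n p nv) where
  open IsDistanceRegular DR
  open GraphMetric G using (dist-sym; dist-triangle)
  open +-*-Solver using (solve; _:+_; _:*_; _:=_; con)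

  private
    d : Fin m → Fin m → ℕ
    d = dist G

    V : List (Fin m)
    V = allFin m

    D : List ℕ
    D = upTo (suc n)

    ∑-V-const : ∀ c → ∑[ x ∈ V ] c ≡ m * c
    ∑-V-const c = trans (∑-const V c) (cong (_* c) (LP.length-tabulate {n = m} (λ x → x)))

  radial-sum : ∀ x (f : ℕ → ℕ) → ∑[ y ∈ V ] f (d x y) ≡ ∑[ k ∈ D ] (nv k * f k)
  radial-sum x f = begin
    ∑[ y ∈ V ] f (d x y)                              ≡⟨ ∑-cong V (λ y → sym (ℕP.*-identityˡ (f (d x y)))) ⟩
    ∑[ y ∈ V ] (⟦ true ⟧ * f (d x y))                 ≡⟨ ∑-by-value n V (d x) (λ _ → true) f (diam-bound x) ⟩
    ∑[ k ∈ D ] (∑[ y ∈ V ] ⟦ d x y ≡ᵇ k ⟧ * f k)     ≡⟨ ∑-cong D (λ k → cong (_* f k) (valency k x)) ⟩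
    ∑[ k ∈ D ] (nv k * f k)                           ∎
    where open ≡-Reasoning

  intersection-sum : ∀ x y (F : ℕ → ℕ → ℕ) →
                     ∑[ u ∈ V ] F (d x u) (d y u) ≡ ∑[ i ∈ D ] ∑[ j ∈ D ] (p i j (d x y) * F i j)
  intersection-sum x y F = begin
    ∑[ u ∈ V ] F (d x u) (d y u)
      ≡⟨ ∑-cong V (λ u → sym (∑-delta₂ (suc n) (d x u) (d y u) F (s≤s (diam-bound x u)) (s≤s (diam-bound y u)))) ⟩
    ∑[ u ∈ V ] ∑[ i ∈ D ] ∑[ j ∈ D ] (⟦ at u i j ⟧ * F i j)
      ≡⟨ ∑-swap V D _ ⟩
    ∑[ i ∈ D ] ∑[ u ∈ V ] ∑[ j ∈ D ] (⟦ at u i j ⟧ * F i j)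
      ≡⟨ ∑-cong D (λ i → ∑-swap V D _) ⟩
    ∑[ i ∈ D ] ∑[ j ∈ D ] ∑[ u ∈ V ] (⟦ at u i j ⟧ * F i j)
      ≡⟨ ∑-cong D (λ i → ∑-cong D (λ j → trans (∑-*ʳ V (F i j) _) (cong (_* F i j) (intersection i j x y)))) ⟩
    ∑[ i ∈ D ] ∑[ j ∈ D ] (p i j (d x y) * F i j) ∎
    where open ≡-Reasoning
          at : Fin m → ℕ → ℕ → Bool
          at u i j = (d x u ≡ᵇ i) ∧ (d y u ≡ᵇ j)

  ballVolume : ℕ → ℕ
  ballVolume t = ∑[ k ∈ D ] (nv k * ⟦ k ≤ᵇ t ⟧)

  ball-volume : ∀ x t → count (inBall G x t) ≡ ballVolume t
  ball-volume x t = radial-sum x (λ k → ⟦ k ≤ᵇ t ⟧)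

  ballOverlap : ℕ → ℕ → ℕ
  ballOverlap t k = ∑[ i ∈ D ] ∑[ j ∈ D ] (p i j k * (⟦ i ≤ᵇ t ⟧ * ⟦ j ≤ᵇ t ⟧))

  ball-overlap : ∀ x y t → ∑[ u ∈ V ] (⟦ d x u ≤ᵇ t ⟧ * ⟦ d y u ≤ᵇ t ⟧) ≡ ballOverlap t (d x y)
  ball-overlap x y t = intersection-sum x y (λ i j → ⟦ i ≤ᵇ t ⟧ * ⟦ j ≤ᵇ t ⟧)

  totalOverlap : ℕ → ℕ
  totalOverlap k = ∑[ t ∈ D ] ballOverlap t k

  total-overlap : ∀ x y → totalOverlap (d x y) ≡ ∑[ u ∈ V ] commonThresholds n (d x u) (d y u)
  total-overlap x y = trans (∑-cong D (λ t → sym (ball-overlap x y t)))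
                            (∑-swap D V (λ t u → ⟦ d x u ≤ᵇ t ⟧ * ⟦ d y u ≤ᵇ t ⟧))

  distanceSum : ℕ
  distanceSum = ∑[ k ∈ D ] (nv k * k)

  distance-sum : ∀ x → ∑[ u ∈ V ] d x u ≡ distanceSum
  distance-sum x = radial-sum x (λ k → k)

  triangle-condition : ∀ x y u → ((∣ d x u - d y u ∣ ≤ᵇ d x y) ∧ (d x y ≤ᵇ d x u + d y u)) ≡ true
  triangle-condition x y u = cong₂ _∧_ (≤ᵇ-true (∣-∣≤ (d x u) (d y u) (d x y) x-side y-side)) (≤ᵇ-true via-u)
    where
      ≤ᵇ-true : ∀ {a b} → a ≤ b → (a ≤ᵇ b) ≡ true
      ≤ᵇ-true a≤b = Equivalence.to T-≡ (ℕP.≤⇒≤ᵇ a≤b)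
      x-side : d x u ≤ d y u + d x y
      x-side = ℕP.≤-trans (dist-triangle connected x y u) (ℕP.≤-reflexive (ℕP.+-comm (d x y) (d y u)))
      y-side : d y u ≤ d x u + d x y
      y-side = ℕP.≤-trans (dist-triangle connected y x u)
                          (ℕP.≤-reflexive (trans (cong (_+ d x u) (dist-sym connected y x)) (ℕP.+-comm (d x y) (d x u))))
      via-u : d x y ≤ d x u + d y u
      via-u = ℕP.≤-trans (dist-triangle connected x u y) (ℕP.≤-reflexive (cong (d x u +_) (dist-sym connected u y)))

  profile-distance : ∀ x y → innerSum n p (d x y) ≡ ∑[ u ∈ V ] ∣ d x u - d y u ∣
  profile-distance x y = begin
    innerSum n p k
      ≡⟨ ∑-cong D (λ i → ∑-cong D (λ j → trans (if-then-0 (window i j) (p i j k * ∣ i - j ∣))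
                                                (solve 3 (λ w q e → w :* (q :* e) := q :* (w :* e)) refl
                                                       ⟦ window i j ⟧ (p i j k) ∣ i - j ∣))) ⟩
    ∑[ i ∈ D ] ∑[ j ∈ D ] (p i j k * (⟦ window i j ⟧ * ∣ i - j ∣))
      ≡⟨ sym (intersection-sum x y (λ i j → ⟦ window i j ⟧ * ∣ i - j ∣)) ⟩
    ∑[ u ∈ V ] (⟦ window (d x u) (d y u) ⟧ * ∣ d x u - d y u ∣)
      ≡⟨ ∑-cong V (λ u → trans (cong (λ b → ⟦ b ⟧ * ∣ d x u - d y u ∣) (triangle-condition x y u))
                               (ℕP.*-identityˡ _)) ⟩
    ∑[ u ∈ V ] ∣ d x u - d y u ∣ ∎
    where open ≡-Reasoning
          k = d x y
          window : ℕ → ℕ → Bool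
          window i j = (∣ i - j ∣ ≤ᵇ k) ∧ (k ≤ᵇ i + j)

  -- The kernel which the key identity shows to be constant on realised distances.
  keyKernel : ℕ → ℕ
  keyKernel k = innerSum n p k + 2 * totalOverlap k + 2 * distanceSum

  -- Key identity: summing threshold-identity over u,
  --   Σ_u ∣d(x,u) − d(y,u)∣ + 2 Σ_t |B(x,t) ∩ B(y,t)| + Σ_u (d(x,u) + d(y,u)) = 2 m (n + 1).
  key-identity : ∀ x y → keyKernel (d x y) ≡ 2 * (m * suc n)
  key-identity x y = begin
    innerSum n p (d x y) + 2 * totalOverlap (d x y) + 2 * distanceSum
      ≡⟨ cong₂ (λ a b → a + 2 * b + 2 * distanceSum) (profile-distance x y) (total-overlap x y) ⟩
    ∑ V diff + 2 * ∑ V common + 2 * distanceSum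
      ≡⟨ cong (∑ V diff + 2 * ∑ V common +_) (trans (solve 1 (λ s → con 2 :* s := s :+ s) refl distanceSum)
                                                    (sym (cong₂ _+_ (distance-sum x) (distance-sum y)))) ⟩
    ∑ V diff + 2 * ∑ V common + (∑ V (d x) + ∑ V (d y))
      ≡⟨ sym (trans (∑-+ V _ _) (cong₂ _+_ (trans (∑-+ V _ _) (cong (∑ V diff +_) (∑-*ˡ V 2 common)))
                                           (∑-+ V (d x) (d y)))) ⟩
    ∑[ u ∈ V ] (diff u + 2 * common u + (d x u + d y u))
      ≡⟨ ∑-cong V (λ u → threshold-identity n (d x u) (d y u) (diam-bound x u) (diam-bound y u)) ⟩
    ∑[ u ∈ V ] (2 * suc n)
      ≡⟨ ∑-V-const (2 * suc n) ⟩
    m * (2 * suc n)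
      ≡⟨ solve 2 (λ m s → m :* (con 2 :* s) := con 2 :* (m :* s)) refl m (suc n) ⟩
    2 * (m * suc n) ∎
    where open ≡-Reasoning
          diff common : Fin m → ℕ
          diff u = ∣ d x u - d y u ∣
          common u = commonThresholds n (d x u) (d y u)

  -- w is the distance distribution of a weighted family of W pairs of vertices:
  -- a function taking the value c at every realised distance has w-sum W·c.
  DistanceDistribution : (ℕ → ℕ) → ℕ → Set
  DistanceDistribution w W = ∀ (f : ℕ → ℕ) c → (∀ x y → f (d x y) ≡ c) → ∑[ k ∈ D ] (w k * f k) ≡ W * c

  key-average : ∀ w W → DistanceDistribution w W →
                ∑[ k ∈ D ] (w k * innerSum n p k) + 2 * ∑[ k ∈ D ] (w k * totalOverlap k) + W * (2 * distanceSum)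
                  ≡ W * (2 * (m * suc n))
  key-average w W distribution = begin
    weighted + W * (2 * distanceSum)        ≡⟨ cong (λ s → weighted + s * (2 * distanceSum)) (sym total-weight) ⟩
    weighted + ∑ D w * (2 * distanceSum)    ≡⟨ sym (∑-weighted-split D w (innerSum n p) totalOverlap (2 * distanceSum)) ⟩
    ∑[ k ∈ D ] (w k * keyKernel k)          ≡⟨ distribution keyKernel _ key-identity ⟩
    W * (2 * (m * suc n))                   ∎
    where
      open ≡-Reasoning
      weighted = ∑[ k ∈ D ] (w k * innerSum n p k) + 2 * ∑[ k ∈ D ] (w k * totalOverlap k)
      total-weight : ∑ D w ≡ W
      total-weight = trans (∑-cong D (λ k → sym (ℕP.*-identityʳ (w k))))
                           (trans (distribution (λ _ → 1) 1 (λ _ _ → refl)) (ℕP.*-identityʳ W))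

  vertex-distribution : ∀ x → DistanceDistribution nv m
  vertex-distribution x f c f≡c = trans (sym (radial-sum x f)) (trans (∑-cong V (λ y → f≡c x y)) (∑-V-const c))

  ball-volume′ : ∀ z t → ∑[ x ∈ V ] ⟦ d x z ≤ᵇ t ⟧ ≡ ballVolume t
  ball-volume′ z t = trans (∑-cong V (λ x → cong (λ e → ⟦ e ≤ᵇ t ⟧) (dist-sym connected x z))) (ball-volume z t)

  -- Σ_t |B(x,t)|² = Σ_k n_k · totalOverlap k: count the pairs (v, u) with u ∈ B(x,t) ∩ B(v,t).
  ball-volume-squares : ∀ x → ∑[ t ∈ D ] (ballVolume t * ballVolume t) ≡ ∑[ k ∈ D ] (nv k * totalOverlap k)
  ball-volume-squares x = begin
    ∑[ t ∈ D ] (ballVolume t * ballVolume t)  ≡⟨ ∑-cong D square ⟩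
    ∑[ t ∈ D ] ∑[ k ∈ D ] (nv k * ballOverlap t k)  ≡⟨ ∑-swap D D _ ⟩
    ∑[ k ∈ D ] ∑[ t ∈ D ] (nv k * ballOverlap t k)  ≡⟨ ∑-cong D (λ k → ∑-*ˡ D (nv k) (λ t → ballOverlap t k)) ⟩
    ∑[ k ∈ D ] (nv k * totalOverlap k) ∎
    where
      open ≡-Reasoning
      square : ∀ t → ballVolume t * ballVolume t ≡ ∑[ k ∈ D ] (nv k * ballOverlap t k)
      square t = begin
        ballVolume t * ballVolume t
          ≡⟨ cong (_* ballVolume t) (sym (ball-volume x t)) ⟩
        ∑[ u ∈ V ] ⟦ d x u ≤ᵇ t ⟧ * ballVolume t
          ≡⟨ sym (∑-*ʳ V (ballVolume t) _) ⟩
        ∑[ u ∈ V ] (⟦ d x u ≤ᵇ t ⟧ * ballVolume t)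
          ≡⟨ ∑-cong V (λ u → trans (cong (⟦ d x u ≤ᵇ t ⟧ *_) (sym (ball-volume′ u t)))
                                   (sym (∑-*ˡ V ⟦ d x u ≤ᵇ t ⟧ (λ v → ⟦ d v u ≤ᵇ t ⟧)))) ⟩
        ∑[ u ∈ V ] ∑[ v ∈ V ] (⟦ d x u ≤ᵇ t ⟧ * ⟦ d v u ≤ᵇ t ⟧)
          ≡⟨ ∑-swap V V _ ⟩
        ∑[ v ∈ V ] ∑[ u ∈ V ] (⟦ d x u ≤ᵇ t ⟧ * ⟦ d v u ≤ᵇ t ⟧)
          ≡⟨ ∑-cong V (λ v → ball-overlap x v t) ⟩
        ∑[ v ∈ V ] ballOverlap t (d x v)
          ≡⟨ radial-sum x (ballOverlap t) ⟩
        ∑[ k ∈ D ] (nv k * ballOverlap t k) ∎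

  first-sum : firstSum n p nv ≡ ∑[ k ∈ D ] (nv k * innerSum n p k)
  first-sum = begin
    ∑[ i ∈ D ] ∑[ j ∈ D ] sumFromTo ∣ i - j ∣ ((i + j) ⊓ n) (λ k → nv k * p i j k * ∣ i - j ∣)
      ≡⟨ ∑-cong D (λ i → ∑-cong D (λ j → sym (∑-window ∣ i - j ∣ (suc n) ((i + j) ⊓ n) _ (s≤s (ℕP.m⊓n≤n (i + j) n))))) ⟩
    ∑[ i ∈ D ] ∑[ j ∈ D ] ∑[ k ∈ D ] (⟦ ∣ i - j ∣ ≤ᵇ k ⟧ * (⟦ k ≤ᵇ (i + j) ⊓ n ⟧ * (nv k * p i j k * ∣ i - j ∣)))
      ≡⟨ ∑-cong D (λ i → ∑-cong D (λ j → ∑-upTo-cong (suc n) (λ k k≤n → term i j k (ℕP.≤-pred k≤n)))) ⟩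
    ∑[ i ∈ D ] ∑[ j ∈ D ] ∑[ k ∈ D ] (nv k * inner i j k)
      ≡⟨ trans (∑-cong D (λ i → ∑-swap D D _)) (∑-swap D D _) ⟩
    ∑[ k ∈ D ] ∑[ i ∈ D ] ∑[ j ∈ D ] (nv k * inner i j k)
      ≡⟨ ∑-cong D (λ k → trans (∑-cong D (λ i → ∑-*ˡ D (nv k) _)) (∑-*ˡ D (nv k) _)) ⟩
    ∑[ k ∈ D ] (nv k * innerSum n p k) ∎
    where
      open ≡-Reasoning
      inner : ℕ → ℕ → ℕ → ℕ
      inner i j k = if (∣ i - j ∣ ≤ᵇ k) ∧ (k ≤ᵇ i + j) then p i j k * ∣ i - j ∣ else 0
      term : ∀ i j k → k ≤ n → ⟦ ∣ i - j ∣ ≤ᵇ k ⟧ * (⟦ k ≤ᵇ (i + j) ⊓ n ⟧ * (nv k * p i j k * ∣ i - j ∣))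
                                ≡ nv k * inner i j k
      term i j k k≤n rewrite ≤ᵇ-⊓ k (i + j) n k≤n | if-then-0 ((∣ i - j ∣ ≤ᵇ k) ∧ (k ≤ᵇ i + j)) (p i j k * ∣ i - j ∣)
                           | ⟦∧⟧ (∣ i - j ∣ ≤ᵇ k) (k ≤ᵇ i + j) =
        solve 5 (λ a b v q e → a :* (b :* (v :* q :* e)) := v :* (a :* b :* (q :* e))) refl
              ⟦ ∣ i - j ∣ ≤ᵇ k ⟧ ⟦ k ≤ᵇ i + j ⟧ (nv k) (p i j k) ∣ i - j ∣

  vertex-average : ∀ x → firstSum n p nv + 2 * ∑[ t ∈ D ] (ballVolume t * ballVolume t) + m * (2 * distanceSum)
                           ≡ m * (2 * (m * suc n))
  vertex-average x = trans (cong₂ (λ a b → a + 2 * b + m * (2 * distanceSum)) first-sum (ball-volume-squares x))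
                           (key-average nv m (vertex-distribution x))

  module _ (Z : Subset m) where

    hits : ℕ → Fin m → ℕ
    hits t x = count (λ z → lookup Z z ∧ inBall G x t z)

    pairCount : ℕ → ℕ
    pairCount k = ∑[ z₁ ∈ V ] ∑[ z₂ ∈ V ] ⟦ lookup Z z₁ ∧ lookup Z z₂ ∧ (d z₁ z₂ ≡ᵇ k) ⟧

    inPair : Fin m → Fin m → ℕ
    inPair z₁ z₂ = ⟦ lookup Z z₁ ∧ lookup Z z₂ ⟧

    pairs-by-distance : ∀ f → ∑[ z₁ ∈ V ] ∑[ z₂ ∈ V ] (inPair z₁ z₂ * f (d z₁ z₂)) ≡ ∑[ k ∈ D ] (pairCount k * f k)
    pairs-by-distance f = begin
      ∑[ z₁ ∈ V ] ∑[ z₂ ∈ V ] (inPair z₁ z₂ * f (d z₁ z₂))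
        ≡⟨ ∑-cong V (λ z₁ → ∑-by-value n V (d z₁) (λ z₂ → lookup Z z₁ ∧ lookup Z z₂) f (diam-bound z₁)) ⟩
      ∑[ z₁ ∈ V ] ∑[ k ∈ D ] (∑[ z₂ ∈ V ] ⟦ (lookup Z z₁ ∧ lookup Z z₂) ∧ (d z₁ z₂ ≡ᵇ k) ⟧ * f k)
        ≡⟨ ∑-swap V D _ ⟩
      ∑[ k ∈ D ] ∑[ z₁ ∈ V ] (∑[ z₂ ∈ V ] ⟦ (lookup Z z₁ ∧ lookup Z z₂) ∧ (d z₁ z₂ ≡ᵇ k) ⟧ * f k)
        ≡⟨ ∑-cong D (λ k → ∑-*ʳ V (f k) _) ⟩
      ∑[ k ∈ D ] (∑[ z₁ ∈ V ] ∑[ z₂ ∈ V ] ⟦ (lookup Z z₁ ∧ lookup Z z₂) ∧ (d z₁ z₂ ≡ᵇ k) ⟧ * f k)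
        ≡⟨ ∑-cong D (λ k → cong (_* f k) (∑-cong V (λ z₁ → ∑-cong V (λ z₂ →
             cong ⟦_⟧ (∧-assoc (lookup Z z₁) (lookup Z z₂) (d z₁ z₂ ≡ᵇ k)))))) ⟩
      ∑[ k ∈ D ] (pairCount k * f k) ∎
      where open ≡-Reasoning

    pairs-total : ∀ c → ∑[ z₁ ∈ V ] ∑[ z₂ ∈ V ] (inPair z₁ z₂ * c) ≡ ∣ Z ∣ * ∣ Z ∣ * c
    pairs-total c = begin
      ∑[ z₁ ∈ V ] ∑[ z₂ ∈ V ] (inPair z₁ z₂ * c)
        ≡⟨ ∑-cong V (λ z₁ → trans (∑-cong V (λ z₂ → cong (_* c) (⟦∧⟧ (lookup Z z₁) (lookup Z z₂)))) (∑-*ʳ V c _)) ⟩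
      ∑[ z₁ ∈ V ] (∑[ z₂ ∈ V ] (⟦ lookup Z z₁ ⟧ * ⟦ lookup Z z₂ ⟧) * c)
        ≡⟨ ∑-*ʳ V c _ ⟩
      ∑[ z₁ ∈ V ] ∑[ z₂ ∈ V ] (⟦ lookup Z z₁ ⟧ * ⟦ lookup Z z₂ ⟧) * c
        ≡⟨ cong (_* c) (sym (∑-product V V (λ z → ⟦ lookup Z z ⟧) (λ z → ⟦ lookup Z z ⟧))) ⟩
      ∑ V (λ z → ⟦ lookup Z z ⟧) * ∑ V (λ z → ⟦ lookup Z z ⟧) * c
        ≡⟨ cong (λ s → s * s * c) (sym (∣∣-as-sum Z)) ⟩
      ∣ Z ∣ * ∣ Z ∣ * c ∎
      where open ≡-Reasoning

    pair-distribution : DistanceDistribution pairCount (∣ Z ∣ * ∣ Z ∣)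
    pair-distribution f c f≡c = begin
      ∑[ k ∈ D ] (pairCount k * f k)                       ≡⟨ sym (pairs-by-distance f) ⟩
      ∑[ z₁ ∈ V ] ∑[ z₂ ∈ V ] (inPair z₁ z₂ * f (d z₁ z₂)) ≡⟨ ∑-cong V (λ z₁ → ∑-cong V (λ z₂ → cong (inPair z₁ z₂ *_) (f≡c z₁ z₂))) ⟩
      ∑[ z₁ ∈ V ] ∑[ z₂ ∈ V ] (inPair z₁ z₂ * c)           ≡⟨ pairs-total c ⟩
      ∣ Z ∣ * ∣ Z ∣ * c ∎
      where open ≡-Reasoning

    hits-sum : ∀ t → ∑[ x ∈ V ] hits t x ≡ ∣ Z ∣ * ballVolume t
    hits-sum t = begin
      ∑[ x ∈ V ] ∑[ z ∈ V ] ⟦ lookup Z z ∧ (d x z ≤ᵇ t) ⟧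
        ≡⟨ ∑-swap V V _ ⟩
      ∑[ z ∈ V ] ∑[ x ∈ V ] ⟦ lookup Z z ∧ (d x z ≤ᵇ t) ⟧
        ≡⟨ ∑-cong V (λ z → trans (∑-cong V (λ x → ⟦∧⟧ (lookup Z z) _)) (∑-*ˡ V ⟦ lookup Z z ⟧ _)) ⟩
      ∑[ z ∈ V ] (⟦ lookup Z z ⟧ * ∑[ x ∈ V ] ⟦ d x z ≤ᵇ t ⟧)
        ≡⟨ ∑-cong V (λ z → cong (⟦ lookup Z z ⟧ *_) (ball-volume′ z t)) ⟩
      ∑[ z ∈ V ] (⟦ lookup Z z ⟧ * ballVolume t)
        ≡⟨ ∑-*ʳ V (ballVolume t) _ ⟩
      ∑ V (λ z → ⟦ lookup Z z ⟧) * ballVolume t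
        ≡⟨ cong (_* ballVolume t) (sym (∣∣-as-sum Z)) ⟩
      ∣ Z ∣ * ballVolume t ∎
      where open ≡-Reasoning

    hits-squares : ∀ t → ∑[ x ∈ V ] (hits t x * hits t x) ≡ ∑[ k ∈ D ] (pairCount k * ballOverlap t k)
    hits-squares t = begin
      ∑[ x ∈ V ] (hits t x * hits t x)
        ≡⟨ ∑-cong V (λ x → ∑-product V V _ _) ⟩
      ∑[ x ∈ V ] ∑[ z₁ ∈ V ] ∑[ z₂ ∈ V ] (⟦ lookup Z z₁ ∧ (d x z₁ ≤ᵇ t) ⟧ * ⟦ lookup Z z₂ ∧ (d x z₂ ≤ᵇ t) ⟧)
        ≡⟨ ∑-cong V (λ x → ∑-cong V (λ z₁ → ∑-cong V (λ z₂ → separate x z₁ z₂))) ⟩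
      ∑[ x ∈ V ] ∑[ z₁ ∈ V ] ∑[ z₂ ∈ V ] (inPair z₁ z₂ * (⟦ d z₁ x ≤ᵇ t ⟧ * ⟦ d z₂ x ≤ᵇ t ⟧))
        ≡⟨ trans (∑-swap V V _) (∑-cong V (λ z₁ → ∑-swap V V _)) ⟩
      ∑[ z₁ ∈ V ] ∑[ z₂ ∈ V ] ∑[ x ∈ V ] (inPair z₁ z₂ * (⟦ d z₁ x ≤ᵇ t ⟧ * ⟦ d z₂ x ≤ᵇ t ⟧))
        ≡⟨ ∑-cong V (λ z₁ → ∑-cong V (λ z₂ → trans (∑-*ˡ V (inPair z₁ z₂) _) (cong (inPair z₁ z₂ *_) (ball-overlap z₁ z₂ t)))) ⟩
      ∑[ z₁ ∈ V ] ∑[ z₂ ∈ V ] (inPair z₁ z₂ * ballOverlap t (d z₁ z₂))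
        ≡⟨ pairs-by-distance (ballOverlap t) ⟩
      ∑[ k ∈ D ] (pairCount k * ballOverlap t k) ∎
      where
        open ≡-Reasoning
        separate : ∀ x z₁ z₂ → ⟦ lookup Z z₁ ∧ (d x z₁ ≤ᵇ t) ⟧ * ⟦ lookup Z z₂ ∧ (d x z₂ ≤ᵇ t) ⟧
                               ≡ inPair z₁ z₂ * (⟦ d z₁ x ≤ᵇ t ⟧ * ⟦ d z₂ x ≤ᵇ t ⟧)
        separate x z₁ z₂
          rewrite ⟦∧⟧ (lookup Z z₁) (d x z₁ ≤ᵇ t) | ⟦∧⟧ (lookup Z z₂) (d x z₂ ≤ᵇ t) | ⟦∧⟧ (lookup Z z₁) (lookup Z z₂)
                | dist-sym connected x z₁ | dist-sym connected x z₂ =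
          solve 4 (λ a b c e → (a :* c) :* (b :* e) := (a :* b) :* (c :* e)) refl
                ⟦ lookup Z z₁ ⟧ ⟦ lookup Z z₂ ⟧ ⟦ d z₁ x ≤ᵇ t ⟧ ⟦ d z₂ x ≤ᵇ t ⟧

    -- The sum Σ_{k=1}^{n} N A_k · innerSum k of the theorem (the k = 0 term vanishes).
    pairSum : ℕ
    pairSum = ∑[ i ∈ upTo n ] (pairCount (suc i) * innerSum n p (suc i))

    pair-sum : ∑[ k ∈ D ] (pairCount k * innerSum n p k) ≡ pairSum
    pair-sum = begin
      ∑[ k ∈ D ] (pairCount k * innerSum n p k)   ≡⟨ ∑-upTo-suc n _ ⟩
      pairCount 0 * innerSum n p 0 + pairSum      ≡⟨ cong (λ z → pairCount 0 * z + pairSum) inner-zero ⟩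
      pairCount 0 * 0 + pairSum                   ≡⟨ cong (_+ pairSum) (ℕP.*-zeroʳ (pairCount 0)) ⟩
      pairSum ∎
      where
        open ≡-Reasoning
        inner-zero : innerSum n p 0 ≡ 0
        inner-zero = ∑-zero D (λ i → ∑-zero D (λ j → vanish i j ∣ i - j ∣))
          where vanish : ∀ i j e → (if (e ≤ᵇ 0) ∧ (0 ≤ᵇ i + j) then p i j 0 * e else 0) ≡ 0
                vanish i j zero    = ℕP.*-zeroʳ (p i j 0)
                vanish i j (suc e) = refl

    pair-average : pairSum + 2 * ∑[ t ∈ D ] ∑[ x ∈ V ] (hits t x * hits t x) + ∣ Z ∣ * ∣ Z ∣ * (2 * distanceSum)
                     ≡ ∣ Z ∣ * ∣ Z ∣ * (2 * (m * suc n))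
    pair-average = trans (cong₂ (λ a b → a + 2 * b + ∣ Z ∣ * ∣ Z ∣ * (2 * distanceSum)) (sym pair-sum) hits-total)
                         (key-average pairCount (∣ Z ∣ * ∣ Z ∣) pair-distribution)
      where
        hits-total : ∑[ t ∈ D ] ∑[ x ∈ V ] (hits t x * hits t x) ≡ ∑[ k ∈ D ] (pairCount k * totalOverlap k)
        hits-total = trans (∑-cong D hits-squares)
                           (trans (∑-swap D D _) (∑-cong D (λ k → ∑-*ˡ D (pairCount k) (λ t → ballOverlap t k))))

    discrepancy-expansion : 0 < ∣ Z ∣ → 0 < m →
      DL2 G n Z ≡ ι (∑[ t ∈ D ] ∑[ x ∈ V ] (hits t x * hits t x)) ℚ.* (frac 1 ∣ Z ∣ ℚ.* frac 1 ∣ Z ∣)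
                  ℚ.- ι (∑[ t ∈ D ] (ballVolume t * ballVolume t)) ℚ.* frac 1 m
    discrepancy-expansion 0<N 0<m = begin
      DL2 G n Z
        ≡⟨ ∑ℚ-cong D (λ t → ∑ℚ-cong V (λ x → cong (λ e → e ℚ.* e) (deviation t x))) ⟩
      ∑ℚ D (λ t → ∑ℚ V (λ x → (ι (hits t x) ℚ.* α ℚ.- ι (ballVolume t) ℚ.* μ) ℚ.* (ι (hits t x) ℚ.* α ℚ.- ι (ballVolume t) ℚ.* μ)))
        ≡⟨ ∑ℚ-cong D (λ t → mean-square V (hits t) ∣ Z ∣ m (ballVolume t) α μ (frac-inverse ∣ Z ∣ 0<N) (frac-inverse m 0<m)
                                        (hits-sum t) (LP.length-tabulate (λ x → x))) ⟩
      ∑ℚ D (λ t → ι (∑[ x ∈ V ] (hits t x * hits t x)) ℚ.* (α ℚ.* α) ℚ.- ι (ballVolume t * ballVolume t) ℚ.* μ)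
        ≡⟨ ∑ℚ-difference D (λ t → ∑[ x ∈ V ] (hits t x * hits t x)) (λ t → ballVolume t * ballVolume t) (α ℚ.* α) μ ⟩
      ι (∑[ t ∈ D ] ∑[ x ∈ V ] (hits t x * hits t x)) ℚ.* (α ℚ.* α) ℚ.- ι (∑[ t ∈ D ] (ballVolume t * ballVolume t)) ℚ.* μ ∎
      where
        open ≡-Reasoning
        α = frac 1 ∣ Z ∣
        μ = frac 1 m
        deviation : ∀ t x → frac (hits t x) ∣ Z ∣ ℚ.- frac (count (inBall G x t)) m
                            ≡ ι (hits t x) ℚ.* α ℚ.- ι (ballVolume t) ℚ.* μ
        deviation t x = cong₂ ℚ._-_ (frac-split (hits t x) ∣ Z ∣ 0<N)
                                    (trans (frac-split (count (inBall G x t)) m 0<m) (cong (λ b → ι b ℚ.* μ) (ball-volume x t)))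

    second-sum : 0 < ∣ Z ∣ → ∑ℚ (upTo n) (λ i → A G Z (suc i) ℚ.* frac (innerSum n p (suc i)) 1) ≡ ι pairSum ℚ.* frac 1 ∣ Z ∣
    second-sum 0<N = trans (∑ℚ-cong (upTo n) (λ i → trans (cong (ℚ._* ι (innerSum n p (suc i))) (frac-split (pairCount (suc i)) ∣ Z ∣ 0<N))
                                                          (ι-regroup (pairCount (suc i)) (innerSum n p (suc i)) (frac 1 ∣ Z ∣))))
                           (∑ℚ-scale (upTo n) (λ i → pairCount (suc i) * innerSum n p (suc i)) (frac 1 ∣ Z ∣))

Fin-nonempty : ∀ {m} → Fin m → 0 < m
Fin-nonempty {suc m} _ = s≤s z≤n

-- Theorem 6.4.  Take any vertex x₀ (one exists, the diameter being attained).
theorem6p4 : {m : ℕ} (G : SimpleGraph m) (n : ℕ) (p : ℕ → ℕ → ℕ → ℕ) (nv : ℕ → ℕ)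
    → IsDistanceRegular G n p nv
    → (Z : Subset m) (N : ℕ) → ∣ Z ∣ ≡ N → 0 < N
    → DL2 G n Z ≡ rhs G n p nv Z
theorem6p4 {m} G n p nv DR Z N ∣Z∣≡N 0<N with IsDistanceRegular.diam-attained DR
... | x₀ , _ = begin
  DL2 G n Z
    ≡⟨ discrepancy-expansion Z 0<∣Z∣ 0<m ⟩
  ι Q ℚ.* (α ℚ.* α) ℚ.- ι B ℚ.* μ
    ≡⟨ combine F B S Q ∣ Z ∣ m (ι (m * suc n) ℚ.- ι distanceSum) α μ (frac-inverse ∣ Z ∣ 0<∣Z∣) (frac-inverse m 0<m)
               (halve F B m distanceSum (m * suc n) (vertex-average x₀))
               (halve S Q (∣ Z ∣ * ∣ Z ∣) distanceSum (m * suc n) (pair-average Z)) ⟩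
  ½ ℚ.* (ι F ℚ.* μ ℚ.- α ℚ.* (ι S ℚ.* α))
    ≡⟨ cong₂ (λ u v → ½ ℚ.* (u ℚ.- α ℚ.* v)) (sym (frac-split F m 0<m)) (sym (second-sum Z 0<∣Z∣)) ⟩
  rhs G n p nv Z ∎
  where
    open ≡-Reasoning
    open DistanceRegularCounting G n p nv DR
    0<∣Z∣ = subst (0 <_) (sym ∣Z∣≡N) 0<N
    0<m = Fin-nonempty x₀
    α = frac 1 ∣ Z ∣
    μ = frac 1 m
    F = firstSum n p nv
    S = pairSum Z
    B = ∑[ t ∈ upTo (suc n) ] (ballVolume t * ballVolume t)
    Q = ∑[ t ∈ upTo (suc n) ] ∑[ x ∈ allFin m ] (hits Z t x * hits Z t x)
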